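{- Let $n$ be a positive integer and let $p$ be a prime such that $p>\max(n+1,3)$. If $n$ is odd, then $$\sum_{0<k_1<\cdots<k_{n}<p}\left(\frac{p-k_{n}}{3}\right)\frac{(-1)^{k_{n}}}{k_1\cdots k_{n}}\equiv -\frac{2^{n+1}+2}{6^{n+1}}\,p\,B_{p-n-1}\left(\frac13\right)\pmod{p^2},$$ and if $n$ is even, then $$\sum_{0<k_1<\cdots<k_{n}<p}\left(\frac{p-k_{n}}{3}\right)\frac{(-1)^{k_{n}}}{k_1\cdots k_{n}}\equiv -\frac{2^{n+1}+4}{n6^n}\,B_{p-n}\left(\frac13\right)\pmod{p}.$$
   Context: The sums run over integers $k_1<\cdots<k_n$ with $0<k_1$ and $k_n<p$. $\left(\frac{\cdot}{3}\right)$ is the Legendre symbol modulo $3$: $\left(\frac{k}{3}\right)=0,1,-1$ according as $k\equiv 0,1,2\pmod 3$. $B_m(x)$ denotes the $m$-th Bernoulli polynomial, defined by $\frac{te^{xt}}{e^t-1}=\sum_{m\ge 0}B_m(x)\frac{t^m}{m!}$. Congruences are between rational numbers whose denominators are prime to $p$: $x\equiv y\pmod{p^s}$ means that $(x-y)/p^s$ has denominator not divisible by $p$. -}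

module Defs where

import Algebra.Definitions.RawSemiring
open import Algebra.Properties.Monoid.Sum using (sum-cong-≗)
open import Data.Fin.Base using (Fin; toℕ)
open import Data.Integer.Base as ℤ using (ℤ; +_; 0ℤ; 1ℤ; -1ℤ; _%ℕ_)
open import Data.Nat.Base as ℕ using (ℕ; zero; suc; _!; _∸_)
open import Data.Nat.Divisibility using (_∤_)
open import Data.Nat.Primality using (Prime; prime⇒nonZero)
open import Data.Nat.Properties using (_!≢0; m^n≢0)
open import Data.Rational.Base
open import Data.Rational.Properties
import Data.Rational.Unnormalised.Base as ℚᵘ
import Data.Rational.Unnormalised.Properties as ℚᵘₚ
open import Data.Vec.Base using (Vec; []; foldr′; last; _∷ʳ_)
open import Relation.Binary.PropositionalEquality

open Algebra.Definitions.RawSemiring +-*-rawSemiring public using (sum; _^_)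

legendre₃ : ℤ → ℤ
legendre₃ a with a %ℕ 3
... | 0 = 0ℤ
... | 1 = 1ℤ
... | _ = -1ℤ

-- Only ever applied to positive numbers below; the value at 0 is a dummy.
recip : ℕ → ℚ
recip zero    = 0ℚ
recip (suc k) = + 1 / suc k

-- ∑₀﹤ₖ﹤ₚ p f  =  f 1 + f 2 + ⋯ + f (p - 1)
∑₀﹤ₖ﹤ₚ : ℕ → (ℕ → ℚ) → ℚ
∑₀﹤ₖ﹤ₚ p f = sum (λ (i : Fin (p ∸ 1)) → f (suc (toℕ i)))

-- The sum of F (k₁ , … , kₙ) over all integers 0 < k₁ < ⋯ < kₙ < p: the
-- outermost sum chooses kₙ, and the remaining indices then lie strictly
-- between 0 and kₙ.
∑-increasing : (n p : ℕ) → (Vec ℕ n → ℚ) → ℚ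
∑-increasing zero    p F = F []
∑-increasing (suc n) p F =
  ∑₀﹤ₖ﹤ₚ p (λ k → ∑-increasing n k (λ ks → F (ks ∷ʳ k)))

summand : (p : ℕ) {n : ℕ} .{{_ : ℕ.NonZero n}} → Vec ℕ n → ℚ
summand p {suc n} ks =
  (legendre₃ (+ p ℤ.- + kₙ) / 1) * (- 1ℚ) ^ kₙ * recip (foldr′ ℕ._*_ 1 ks)
  where kₙ = last ks

legendreSum : (n : ℕ) .{{_ : ℕ.NonZero n}} → ℕ → ℚ
legendreSum n p = ∑-increasing n p (summand p)

-- The coefficient sequence of a formal power series in t.
PowerSeries : Set
PowerSeries = ℕ → ℚ

infixl 7 _⊛_

_⊛_ : PowerSeries → PowerSeries → PowerSeries
(f ⊛ g) n = sum (λ (i : Fin (suc n)) → f (toℕ i) * g (n ∸ toℕ i))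

t·_ : PowerSeries → PowerSeries
(t· f) zero    = 0ℚ
(t· f) (suc k) = f k

-- Division by t, for series without constant term.
t⁻¹·_ : PowerSeries → PowerSeries
(t⁻¹· f) k = f (suc k)

-- Long division.
quotient : (f g : PowerSeries) .{{_ : NonZero (g 0)}} → PowerSeries
quotient f g zero    = f 0 ÷ g 0
quotient f g (suc n) =
  quotient (λ k → f (suc k) - (f 0 ÷ g 0) * g (suc k)) g n

exp[_t] : ℚ → PowerSeries
exp[ x t] k = x ^ k * recip (k !)

-- e^t − 1; the constant term e^0 − 1 vanishes.
exp[t]-1 : PowerSeries
exp[t]-1 zero    = 0ℚ
exp[t]-1 (suc k) = exp[ 1ℚ t] (suc k)

-- t e^{xt} / (e^t − 1), computed after cancelling t, so that the divisor
-- has constant term 1.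
bernoulliSeries : ℚ → PowerSeries
bernoulliSeries x = quotient (t⁻¹· (t· exp[ x t])) (t⁻¹· exp[t]-1)

-- The Bernoulli polynomial B_m(x) is m! times the coefficient of t^m.
bernoulli : ℕ → ℚ → ℚ
bernoulli m x = (+ (m !) / 1) * bernoulliSeries x m

quotient-⊛ : ∀ f g .{{_ : NonZero (g 0)}} n → (quotient f g ⊛ g) n ≡ f n
quotient-⊛ f g zero = begin
  f 0 ÷ g 0 * g 0 + 0ℚ        ≡⟨ +-identityʳ _ ⟩
  f 0 * (1/ g 0) * g 0        ≡⟨ *-assoc (f 0) (1/ g 0) (g 0) ⟩
  f 0 * ((1/ g 0) * g 0)      ≡⟨ cong (f 0 *_) (*-inverseˡ (g 0)) ⟩
  f 0 * 1ℚ                    ≡⟨ *-identityʳ (f 0) ⟩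
  f 0                         ∎
  where open ≡-Reasoning
quotient-⊛ f g (suc n) = begin
  c + (quotient f′ g ⊛ g) n       ≡⟨ cong (_+_ c) (quotient-⊛ f′ g n) ⟩
  c + (f (suc n) - c)             ≡⟨ +-comm c _ ⟩
  f (suc n) - c + c               ≡⟨ +-assoc (f (suc n)) (- c) c ⟩
  f (suc n) + (- c + c)           ≡⟨ cong (_+_ (f (suc n))) (+-inverseˡ c) ⟩
  f (suc n) + 0ℚ                  ≡⟨ +-identityʳ _ ⟩
  f (suc n)                       ∎
  where
  open ≡-Reasoning
  c = (f 0 ÷ g 0) * g (suc n)
  f′ = λ k → f (suc k) - (f 0 ÷ g 0) * g (suc k)

⊛-t⁻¹ : ∀ f g → g 0 ≡ 0ℚ → ∀ n → (f ⊛ g) (suc n) ≡ (f ⊛ (t⁻¹· g)) n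
⊛-t⁻¹ f g g₀≡0 zero = cong (_+_ (f 0 * g 1))
  (trans (+-identityʳ _) (trans (cong (f 1 *_) g₀≡0) (*-zeroʳ (f 1))))
⊛-t⁻¹ f g g₀≡0 (suc n) =
  cong (_+_ (f 0 * g (suc (suc n)))) (⊛-t⁻¹ (λ k → f (suc k)) g g₀≡0 n)

-- (∑ B_m(x) t^m / m!) (e^t − 1) = t e^{xt}
bernoulli-generating : ∀ x m →
  ((λ k → bernoulli k x * recip (k !)) ⊛ exp[t]-1) m ≡ (t· exp[ x t]) m
bernoulli-generating x m = trans
  (sum-cong-≗ +-0-monoid {suc m} (λ i → cong (_* exp[t]-1 (m ∸ toℕ i)) (egf (toℕ i))))
  (coeff m)
  where
  recip-cancel : ∀ k .{{_ : ℕ.NonZero k}} → (+ k / 1) * recip k ≡ 1ℚ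
  recip-cancel (suc k) = toℚᵘ-injective (begin
    toℚᵘ ((+ suc k / 1) * (+ 1 / suc k))           ≈⟨ toℚᵘ-homo-* (+ suc k / 1) (+ 1 / suc k) ⟩
    toℚᵘ (+ suc k / 1) ℚᵘ.* toℚᵘ (+ 1 / suc k)     ≈⟨ ℚᵘₚ.*-cong (toℚᵘ-fromℚᵘ k/1) (toℚᵘ-fromℚᵘ 1/k) ⟩
    k/1 ℚᵘ.* 1/k                                   ≈⟨ ℚᵘₚ.*-inverseʳ k/1 ⟩
    toℚᵘ 1ℚ                                        ∎)
    where
    open import Relation.Binary.Reasoning.Setoid ℚᵘₚ.≃-setoid
    k/1 = ℚᵘ.mkℚᵘ (+ suc k) 0
    1/k = ℚᵘ.mkℚᵘ (+ 1) k

  egf : ∀ k → bernoulli k x * recip (k !) ≡ bernoulliSeries x k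
  egf k = begin
    k! * b * r      ≡⟨ cong (_* r) (*-comm k! b) ⟩
    b * k! * r      ≡⟨ *-assoc b k! r ⟩
    b * (k! * r)    ≡⟨ cong (b *_) (recip-cancel (k !) {{k !≢0}}) ⟩
    b * 1ℚ          ≡⟨ *-identityʳ b ⟩
    b               ∎
    where
    open ≡-Reasoning
    k! = + (k !) / 1
    b = bernoulliSeries x k
    r = recip (k !)

  coeff : ∀ m → (bernoulliSeries x ⊛ exp[t]-1) m ≡ (t· exp[ x t]) m
  coeff zero    = trans (+-identityʳ _) (*-zeroʳ (bernoulliSeries x 0))
  coeff (suc n) = trans (⊛-t⁻¹ (bernoulliSeries x) exp[t]-1 refl n)
                        (quotient-⊛ (t⁻¹· (t· exp[ x t])) (t⁻¹· exp[t]-1) n)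

infix 4 _≡_[mod_^_]

-- Both sides are required to be p-integral.
record _≡_[mod_^_] (x y : ℚ) {p : ℕ} (p-prime : Prime p) (s : ℕ) : Set where
  private instance
    p^s≢0 : ℕ.NonZero (p ℕ.^ s)
    p^s≢0 = m^n≢0 p s {{prime⇒nonZero p-prime}}
  field
    integralˡ : p ∤ ↧ₙ x
    integralʳ : p ∤ ↧ₙ y
    congruent : p ∤ ↧ₙ ((x - y) * (+ 1 / (p ℕ.^ s)))

{-# OPTIONS --safe #-}
module Submission where

-- The coefficients (k/3) (-1)^(k+1) are those of x / (1 - x + x²), so the left-hand side is the
-- coefficient of y^n in the polynomial W(y) = [x^p] x (1 - x)^(-y) / (1 - x + x²), which satisfies
--   W(y + 1) - W(y) + W(y - 1) = C(y + p - 1, p - 1).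
-- The right-hand side is invariant under y ↦ - p - y, hence so is W, and comparing coefficients
-- gives 2 [y^n] W ≡ p (n + 1) [y^(n+1)] W (mod p²) for odd n: the odd case follows from the even one.
-- For the even case, C(y + p - 1, p - 1) ≡ 1 - y^(p-1) (mod p), and inverting e^D - 1 + e^(-D), with
-- D = d/dy, gives n! [y^n] W ≡ [t^(p-1-n)] 1 / (e^t - 1 + e^(-t)). With x = e^t,
--   x / (x² - x + 1) = x / (x² + x + 1) + 2 x² / (x⁴ + x² + 1),
-- and - u / (2 (u² + u + 1)) is the even part of e^(s/3) / (e^s - 1) for u = e^(s/3), so s = 3t and
-- s = 6t yield Bernoulli polynomials at 1/3. Wilson and Fermat clear factorials and powers.

-- The equation for W is one cancellation: shifting y by 1 or -1 multiplies (1 - x)^(-y) by 1 / (1 -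
-- x) or 1 - x, and 1 / (1 - x) - 1 + (1 - x) = (1 - x + x²) / (1 - x), so the quadratic denominator
-- disappears and x (1 - x)^(-y-1) remains. The variable y counts indices because C(y + k - 1, k) is
-- y / k times the product of 1 + y / j over 0 < j < k. Reversing the coefficients of a polynomial
-- in y and weighting them by factorials makes D multiplication by t, so inverting an operator
-- becomes dividing by a power series with constant coefficient 1. The price is truncation: the
-- encoding refers to a degree bound and respects shifts of y only up to that power of t. Division
-- keeps p-integrality only while no p! occurs in a denominator, hence the ranges ending at t^(p-1)
-- or t^(p-2). Division by X modulo p determines W only modulo p. It is the symmetry, whose shift is
-- by p itself, that supplies one more power of p for odd n, where the residue modulo p is 0 because
-- 1 / X is an even series.

module Proof where

  open import Algebra.Bundles using (CommutativeRing)
  import Algebra.Properties.CommutativeSemiring.Exp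
  import Algebra.Properties.Monoid.Sum
  import Algebra.Properties.Semiring.Sum
  import Algebra.Solver.Ring
  open import Algebra.Solver.Ring.AlmostCommutativeRing
    using (_-Raw-AlmostCommutative⟶_; fromCommutativeRing)
  open import Data.Fin.Base using (toℕ)
  import Data.Fin.Properties as Finₚ
  open import Data.Integer.Base as ℤ using (ℤ; +_)
  import Data.Integer.Properties as ℤₚ
  open import Data.Maybe.Base using (Maybe; just; nothing)
  open import Data.Nat.Base as ℕ using (ℕ; zero; suc; _!; _∸_; z≤n; s≤s)
  import Data.Nat.Coprimality as Coprimality
  open import Data.Nat.Divisibility
    using (_∣_; _∤_; divides; ∣-trans; ∣-refl; >⇒∤; ∣1⇒≡1; ∣m∣n⇒∣m+n; _∣0)
  open import Data.Nat.Primality using (Prime; euclidsLemma; prime⇒irreducible)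
  import Data.Nat.Properties as ℕₚ
  open import Data.Product.Base using (_,_)
  open import Data.Rational.Base as ℚ
    using (ℚ; mkℚ; 0ℚ; 1ℚ; _/_; toℚᵘ; ↧ₙ_; -_; _+_; _*_; _-_)
  import Data.Rational.Properties as ℚₚ
  open import Data.Rational.Solver using (module +-*-Solver)
  import Data.Rational.Unnormalised.Base as ℚᵘ
  import Data.Rational.Unnormalised.Properties as ℚᵘₚ
  open import Data.Sum.Base using (inj₁; inj₂; [_,_])
  open import Data.Unit.Base using (⊤)
  open import Data.Vec.Base using (Vec; []; _∷_; foldr′; _∷ʳ_)
  open import Data.Vec.Properties using (last-∷ʳ)
  open import Function.Base using (_∘_)
  open import Level using (0ℓ)
  open import Relation.Binary.PropositionalEquality hiding ([_])
  open import Relation.Nullary.Decidable using (yes; no; recompute)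
  open import Relation.Nullary.Negation using (contradiction)
  open import Defs

  open +-*-Solver using (solve; _:=_; _:+_; _:*_; :-_; con)
    renaming (_:-_ to _⊝_)

  -- Rational numbers and formal power series

  module Sumℚ where
    open Algebra.Properties.Monoid.Sum ℚₚ.+-0-monoid public
      using (sum-cong-≗; sum-init-last)
    open Algebra.Properties.Semiring.Sum (CommutativeRing.semiring ℚₚ.+-*-commutativeRing) public
      using (*-distribˡ-sum)

  ιᶻ : ℤ → ℚ
  ιᶻ a = a / 1

  ι : ℕ → ℚ
  ι n = ιᶻ (+ n)

  /-≃ : ∀ a d .{{_ : ℕ.NonZero d}} → toℚᵘ (a / d) ℚᵘ.≃ a ℚᵘ./ d
  /-≃ a (suc d) = ℚₚ.toℚᵘ-fromℚᵘ (ℚᵘ.mkℚᵘ a d)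

  ιᶻ-+ : ∀ a b → ιᶻ (a ℤ.+ b) ≡ ιᶻ a + ιᶻ b
  ιᶻ-+ a b = ℚₚ.toℚᵘ-injective (begin
    toℚᵘ (ιᶻ (a ℤ.+ b))            ≈⟨ /-≃ (a ℤ.+ b) 1 ⟩
    ℚᵘ.mkℚᵘ (a ℤ.+ b) 0            ≈⟨ ℚᵘ.*≡* (cong (ℤ._* + 1) (cong₂ ℤ._+_ (sym (ℤₚ.*-identityʳ a))
        (sym (ℤₚ.*-identityʳ b)))) ⟩
    ℚᵘ.mkℚᵘ a 0 ℚᵘ.+ ℚᵘ.mkℚᵘ b 0   ≈⟨ ℚᵘₚ.+-cong (/-≃ a 1) (/-≃ b 1) ⟨
    toℚᵘ (ιᶻ a) ℚᵘ.+ toℚᵘ (ιᶻ b)   ≈⟨ ℚₚ.toℚᵘ-homo-+ (ιᶻ a) (ιᶻ b) ⟨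
    toℚᵘ (ιᶻ a + ιᶻ b)             ∎)
    where open import Relation.Binary.Reasoning.Setoid ℚᵘₚ.≃-setoid

  ιᶻ-* : ∀ a b → ιᶻ (a ℤ.* b) ≡ ιᶻ a * ιᶻ b
  ιᶻ-* a b = ℚₚ.toℚᵘ-injective (begin
    toℚᵘ (ιᶻ (a ℤ.* b))            ≈⟨ /-≃ (a ℤ.* b) 1 ⟩
    ℚᵘ.mkℚᵘ a 0 ℚᵘ.* ℚᵘ.mkℚᵘ b 0   ≈⟨ ℚᵘₚ.*-cong (/-≃ a 1) (/-≃ b 1) ⟨
    toℚᵘ (ιᶻ a) ℚᵘ.* toℚᵘ (ιᶻ b)   ≈⟨ ℚₚ.toℚᵘ-homo-* (ιᶻ a) (ιᶻ b) ⟨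
    toℚᵘ (ιᶻ a * ιᶻ b)             ∎)
    where open import Relation.Binary.Reasoning.Setoid ℚᵘₚ.≃-setoid

  ι-+ : ∀ m n → ι (m ℕ.+ n) ≡ ι m + ι n
  ι-+ m n = ιᶻ-+ (+ m) (+ n)

  ι-* : ∀ m n → ι (m ℕ.* n) ≡ ι m * ι n
  ι-* m n = trans (cong ιᶻ (ℤₚ.pos-* m n)) (ιᶻ-* (+ m) (+ n))

  ι-suc : ∀ n → ι (suc n) ≡ 1ℚ + ι n
  ι-suc = ι-+ 1

  /-cancel : ∀ a d .{{_ : ℕ.NonZero d}} → (a / d) * ι d ≡ ιᶻ a
  /-cancel a d@(suc d-1) = ℚₚ.toℚᵘ-injective (begin
    toℚᵘ ((a / d) * ι d)              ≈⟨ ℚₚ.toℚᵘ-homo-* (a / d) (ι d) ⟩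
    toℚᵘ (a / d) ℚᵘ.* toℚᵘ (ι d)      ≈⟨ ℚᵘₚ.*-cong (/-≃ a d) (/-≃ (+ d) 1) ⟩
    ℚᵘ.mkℚᵘ a d-1 ℚᵘ.* ℚᵘ.mkℚᵘ (+ d) 0 ≈⟨ ℚᵘ.*≡* (trans (ℤₚ.*-identityʳ _) (cong (λ e → a ℤ.* + e) (sym
        (ℕₚ.*-identityʳ d)))) ⟩
    ℚᵘ.mkℚᵘ a 0                       ≈⟨ /-≃ a 1 ⟨
    toℚᵘ (ιᶻ a)                       ∎)
    where open import Relation.Binary.Reasoning.Setoid ℚᵘₚ.≃-setoid

  recip-cancel : ∀ k .{{_ : ℕ.NonZero k}} → recip k * ι k ≡ 1ℚ
  recip-cancel (suc k) = /-cancel (+ 1) (suc k)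

  ι-cancel : ∀ k .{{_ : ℕ.NonZero k}} {x y} → ι k * x ≡ ι k * y → x ≡ y
  ι-cancel k {x} {y} eq = begin
    x                    ≡⟨ lemma x ⟨
    recip k * (ι k * x)  ≡⟨ cong (recip k *_) eq ⟩
    recip k * (ι k * y)  ≡⟨ lemma y ⟩
    y                    ∎
    where
    open ≡-Reasoning
    lemma : ∀ z → recip k * (ι k * z) ≡ z
    lemma z = begin
      recip k * (ι k * z) ≡⟨ ℚₚ.*-assoc (recip k) (ι k) z ⟨
      recip k * ι k * z   ≡⟨ cong (_* z) (recip-cancel k) ⟩
      1ℚ * z              ≡⟨ ℚₚ.*-identityˡ z ⟩
      z                   ∎

  recip-unique : ∀ k .{{_ : ℕ.NonZero k}} {x} → ι k * x ≡ 1ℚ → x ≡ recip k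
  recip-unique k eq = ι-cancel k (trans eq (sym (trans (ℚₚ.*-comm (ι k) (recip k)) (recip-cancel k))))

  recip-* : ∀ m n .{{_ : ℕ.NonZero m}} .{{_ : ℕ.NonZero n}} → recip (m ℕ.* n) ≡ recip m * recip n
  recip-* m n = sym (recip-unique (m ℕ.* n) {{ℕₚ.m*n≢0 m n}} (begin
    ι (m ℕ.* n) * (recip m * recip n)      ≡⟨ cong (_* (recip m * recip n)) (ι-* m n) ⟩
    ι m * ι n * (recip m * recip n)        ≡⟨ solve 4 (λ a b c d → a :* b :* (c :* d) := c :* a :* (d :* b))
        refl (ι m) (ι n) (recip m) (recip n) ⟩
    recip m * ι m * (recip n * ι n)        ≡⟨ cong₂ _*_ (recip-cancel m) (recip-cancel n) ⟩
    1ℚ                                     ∎))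
    where open ≡-Reasoning

  recip-suc! : ∀ k → ι (suc k) * recip (suc k !) ≡ recip (k !)
  recip-suc! k = recip-unique (k !) {{ℕₚ._!≢0 k}} (begin
    ι (k !) * (ι (suc k) * r)   ≡⟨ solve 3 (λ a b c → a :* (b :* c) := c :* (b :* a)) refl (ι (k !)) (ι (suc k)) r ⟩
    r * (ι (suc k) * ι (k !))   ≡⟨ cong (r *_) (ι-* (suc k) (k !)) ⟨
    r * ι (suc k !)             ≡⟨ recip-cancel (suc k !) {{ℕₚ._!≢0 (suc k)}} ⟩
    1ℚ                          ∎)
    where
    open ≡-Reasoning
    r = recip (suc k !)

  -- Used with _~_ being equality, and with a predicate on the left argument.
  ⊛-rel : (_~_ : ℚ → ℚ → Set) → (∀ {a b c d} → a ~ b → c ~ d → (a + c) ~ (b + d)) → 0ℚ ~ 0ℚ →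
    ∀ f f′ g g′ n → (∀ i j → i ℕ.+ j ≡ n → (f i * g j) ~ (f′ i * g′ j)) →
    (f ⊛ g) n ~ (f′ ⊛ g′) n
  ⊛-rel _~_ +-~ 0~0 f f′ g g′ zero    H = +-~ (H 0 0 refl) 0~0
  ⊛-rel _~_ +-~ 0~0 f f′ g g′ (suc n) H =
    +-~ (H 0 (suc n) refl)
        (⊛-rel _~_ +-~ 0~0 (f ∘ suc) (f′ ∘ suc) g g′ n (λ i j eq → H (suc i) j (cong suc eq)))

  infixl 6 _⊕_
  _⊕_ : PowerSeries → PowerSeries → PowerSeries
  (f ⊕ g) k = f k + g k

  ⊖_ : PowerSeries → PowerSeries
  (⊖ f) k = - f k

  C : ℚ → PowerSeries
  C a zero    = a
  C a (suc _) = 0ℚ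

  𝟎 𝟏 T : PowerSeries
  𝟎 _ = 0ℚ
  𝟏 = C 1ℚ
  T = t· 𝟏

  ⊛-cong : ∀ {f f′ g g′} → f ≗ f′ → g ≗ g′ → f ⊛ g ≗ f′ ⊛ g′
  ⊛-cong {f} {f′} {g} {g′} f≗ g≗ n =
    ⊛-rel _≡_ (cong₂ _+_) refl f f′ g g′ n (λ i j _ → cong₂ _*_ (f≗ i) (g≗ j))

  -- `_⊛_` recurses by peeling off the first coefficient of the left factor; peeling off its last
  -- one instead is what commutativity needs.
  ⊛-sucʳ : ∀ f g n → (f ⊛ g) (suc n) ≡ f (suc n) * g 0 + (f ⊛ (g ∘ suc)) n
  ⊛-sucʳ f g zero    = solve 5 (λ a b c d z → a :* c :+ (b :* d :+ z) := b :* d :+ (a :* c :+ z)) refl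
                         (f 0) (f 1) (g 1) (g 0) 0ℚ
  ⊛-sucʳ f g (suc n) = begin
    f 0 * g (2 ℕ.+ n) + ((f ∘ suc) ⊛ g) (suc n)
      ≡⟨ cong (_+_ (f 0 * g (2 ℕ.+ n))) (⊛-sucʳ (f ∘ suc) g n) ⟩
    f 0 * g (2 ℕ.+ n) + (f (2 ℕ.+ n) * g 0 + ((f ∘ suc) ⊛ (g ∘ suc)) n)
      ≡⟨ solve 3 (λ a b c → a :+ (b :+ c) := b :+ (a :+ c)) refl
           (f 0 * g (2 ℕ.+ n)) (f (2 ℕ.+ n) * g 0) (((f ∘ suc) ⊛ (g ∘ suc)) n) ⟩
    f (2 ℕ.+ n) * g 0 + (f ⊛ (g ∘ suc)) (suc n) ∎
    where open ≡-Reasoning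

  ⊛-comm : ∀ f g → f ⊛ g ≗ g ⊛ f
  ⊛-comm f g zero    = cong (_+ 0ℚ) (ℚₚ.*-comm (f 0) (g 0))
  ⊛-comm f g (suc n) = begin
    f 0 * g (suc n) + ((f ∘ suc) ⊛ g) n  ≡⟨ cong₂ _+_ (ℚₚ.*-comm (f 0) (g (suc n))) (⊛-comm (f ∘ suc) g n) ⟩
    g (suc n) * f 0 + (g ⊛ (f ∘ suc)) n  ≡⟨ ⊛-sucʳ g f n ⟨
    (g ⊛ f) (suc n)                      ∎
    where open ≡-Reasoning

  ⊛-distribˡ : ∀ f g h → f ⊛ (g ⊕ h) ≗ (f ⊛ g) ⊕ (f ⊛ h)
  ⊛-distribˡ f g h zero    = solve 4 (λ a b c z → a :* (b :+ c) :+ con 0ℚ := a :* b :+ con 0ℚ :+ (a :* c :+ con 0ℚ))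
      refl (f 0) (g 0) (h 0) 0ℚ
  ⊛-distribˡ f g h (suc n) = begin
    f 0 * (g (suc n) + h (suc n)) + ((f ∘ suc) ⊛ (g ⊕ h)) n
      ≡⟨ cong (_+_ (f 0 * (g (suc n) + h (suc n)))) (⊛-distribˡ (f ∘ suc) g h n) ⟩
    f 0 * (g (suc n) + h (suc n)) + (((f ∘ suc) ⊛ g) n + ((f ∘ suc) ⊛ h) n)
      ≡⟨ solve 5 (λ a b c d e → a :* (b :+ c) :+ (d :+ e) := a :* b :+ d :+ (a :* c :+ e)) refl
           (f 0) (g (suc n)) (h (suc n)) (((f ∘ suc) ⊛ g) n) (((f ∘ suc) ⊛ h) n) ⟩
    ((f ⊛ g) ⊕ (f ⊛ h)) (suc n) ∎
    where open ≡-Reasoning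

  ⊛-distribʳ : ∀ f g h → (g ⊕ h) ⊛ f ≗ (g ⊛ f) ⊕ (h ⊛ f)
  ⊛-distribʳ f g h n = begin
    ((g ⊕ h) ⊛ f) n         ≡⟨ ⊛-comm (g ⊕ h) f n ⟩
    (f ⊛ (g ⊕ h)) n         ≡⟨ ⊛-distribˡ f g h n ⟩
    ((f ⊛ g) ⊕ (f ⊛ h)) n   ≡⟨ cong₂ _+_ (⊛-comm f g n) (⊛-comm f h n) ⟩
    ((g ⊛ f) ⊕ (h ⊛ f)) n   ∎
    where open ≡-Reasoning

  ⊛-scale : ∀ a f g → (λ k → a * f k) ⊛ g ≗ (λ k → a * (f ⊛ g) k)
  ⊛-scale a f g zero    = solve 3 (λ a b c → a :* b :* c :+ con 0ℚ := a :* (b :* c :+ con 0ℚ)) refl a (f 0) (g 0)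
  ⊛-scale a f g (suc n) = begin
    a * f 0 * g (suc n) + ((λ k → a * f (suc k)) ⊛ g) n
      ≡⟨ cong (_+_ (a * f 0 * g (suc n))) (⊛-scale a (f ∘ suc) g n) ⟩
    a * f 0 * g (suc n) + a * ((f ∘ suc) ⊛ g) n
      ≡⟨ solve 4 (λ a b c d → a :* b :* c :+ a :* d
          := a :* (b :* c :+ d)) refl a (f 0) (g (suc n)) (((f ∘ suc) ⊛ g) n) ⟩
    a * (f ⊛ g) (suc n) ∎
    where open ≡-Reasoning

  ⊛-assoc : ∀ f g h → (f ⊛ g) ⊛ h ≗ f ⊛ (g ⊛ h)
  ⊛-assoc f g h zero    = solve 3 (λ a b c → (a :* b :+ con 0ℚ) :* c :+ con 0ℚ := a :* (b :* c :+ con 0ℚ) :+ con 0ℚ)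
      refl (f 0) (g 0) (h 0)
  ⊛-assoc f g h (suc n) = begin
    (f ⊛ g) 0 * h (suc n) + ((λ k → (f ⊛ g) (suc k)) ⊛ h) n
      ≡⟨ cong (_+_ ((f ⊛ g) 0 * h (suc n))) (⊛-distribʳ h (λ k → f 0 * g (suc k)) ((f ∘ suc) ⊛ g) n) ⟩
    (f ⊛ g) 0 * h (suc n) + (((λ k → f 0 * g (suc k)) ⊛ h) n + (((f ∘ suc) ⊛ g) ⊛ h) n)
      ≡⟨ cong₂ (λ x y → (f ⊛ g) 0 * h (suc n) + (x + y)) (⊛-scale (f 0) (g ∘ suc) h n) (⊛-assoc (f ∘ suc) g h n) ⟩
    (f ⊛ g) 0 * h (suc n) + (f 0 * ((g ∘ suc) ⊛ h) n + ((f ∘ suc) ⊛ (g ⊛ h)) n)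
      ≡⟨ solve 5 (λ a b c d e → (a :* b :+ con 0ℚ) :* c :+ (a :* d :+ e) := a :* (b :* c :+ d) :+ e) refl
           (f 0) (g 0) (h (suc n)) (((g ∘ suc) ⊛ h) n) (((f ∘ suc) ⊛ (g ⊛ h)) n) ⟩
    (f ⊛ (g ⊛ h)) (suc n) ∎
    where open ≡-Reasoning

  𝟎-⊛ : ∀ g → 𝟎 ⊛ g ≗ 𝟎
  𝟎-⊛ g zero    = trans (ℚₚ.+-identityʳ _) (ℚₚ.*-zeroˡ (g 0))
  𝟎-⊛ g (suc n) = trans (cong₂ _+_ (ℚₚ.*-zeroˡ (g (suc n))) (𝟎-⊛ g n)) (ℚₚ.+-identityʳ 0ℚ)

  C-⊛ : ∀ a g → C a ⊛ g ≗ (λ k → a * g k)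
  C-⊛ a g zero    = ℚₚ.+-identityʳ _
  C-⊛ a g (suc n) = trans (cong (_+_ (a * g (suc n))) (𝟎-⊛ g n)) (ℚₚ.+-identityʳ _)

  𝟏-⊛ : ∀ g → 𝟏 ⊛ g ≗ g
  𝟏-⊛ g n = trans (C-⊛ 1ℚ g n) (ℚₚ.*-identityˡ (g n))

  T-⊛ : ∀ g → T ⊛ g ≗ t· g
  T-⊛ g zero    = trans (ℚₚ.+-identityʳ _) (ℚₚ.*-zeroˡ (g 0))
  T-⊛ g (suc n) = trans (cong₂ _+_ (ℚₚ.*-zeroˡ (g (suc n))) (𝟏-⊛ g n)) (ℚₚ.+-identityˡ (g n))

  series-commutativeRing : CommutativeRing 0ℓ 0ℓ
  series-commutativeRing = record
    { Carrier = PowerSeries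
    ; _≈_ = _≗_
    ; _+_ = _⊕_
    ; _*_ = _⊛_
    ; -_ = ⊖_
    ; 0# = 𝟎
    ; 1# = 𝟏
    ; isCommutativeRing = record
      { isRing = record
        { +-isAbelianGroup = record
          { isGroup = record
            { isMonoid = record
              { isSemigroup = record
                { isMagma = record
                  { isEquivalence = record
                    { refl = λ _ → refl
                    ; sym = λ eq k → sym (eq k)
                    ; trans = λ eq eq′ k → trans (eq k) (eq′ k)
                    }
                  ; ∙-cong = λ eq eq′ k → cong₂ _+_ (eq k) (eq′ k)
                  }
                ; assoc = λ f g h k → ℚₚ.+-assoc (f k) (g k) (h k)
                }
              ; identity = (λ f k → ℚₚ.+-identityˡ (f k)) , (λ f k → ℚₚ.+-identityʳ (f k))
              }
            ; inverse = (λ f k → ℚₚ.+-inverseˡ (f k)) , (λ f k → ℚₚ.+-inverseʳ (f k))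
            ; ⁻¹-cong = λ eq k → cong -_ (eq k)
            }
          ; comm = λ f g k → ℚₚ.+-comm (f k) (g k)
          }
        ; *-cong = ⊛-cong
        ; *-assoc = ⊛-assoc
        ; *-identity = 𝟏-⊛ , (λ f n → trans (⊛-comm f 𝟏 n) (𝟏-⊛ f n))
        ; distrib = ⊛-distribˡ , ⊛-distribʳ
        }
      ; *-comm = ⊛-comm
      }
    }

  -- Through this map the ring solver for series computes with rational coefficients, as the
  -- identity behind `X-Y` with its constants 3 and 6 requires.
  C-homomorphism : CommutativeRing.rawRing ℚₚ.+-*-commutativeRing
                     -Raw-AlmostCommutative⟶ fromCommutativeRing series-commutativeRing
  C-homomorphism = record
    { ⟦_⟧ = C
    ; +-homo = λ { a b zero → refl ; a b (suc k) → refl }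
    ; *-homo = λ { a b zero → sym (ℚₚ.+-identityʳ _)
                 ; a b (suc k) → sym (trans (C-⊛ a (C b) (suc k)) (ℚₚ.*-zeroʳ a)) }
    ; -‿homo = λ { a zero → refl ; a (suc k) → refl }
    ; 0-homo = λ { zero → refl ; (suc k) → refl }
    ; 1-homo = λ _ → refl
    }

  C-≟ : ∀ a b → Maybe (C a ≗ C b)
  C-≟ a b with a ℚₚ.≟ b
  ... | yes eq = just (λ k → cong (λ c → C c k) eq)
  ... | no  _  = nothing

  module Series = Algebra.Solver.Ring (CommutativeRing.rawRing ℚₚ.+-*-commutativeRing)
    (fromCommutativeRing series-commutativeRing) C-homomorphism C-≟

  open Series using ()
    renaming (solve to solveₛ; _:=_ to _≐_; _:+_ to _⊞_; _:*_ to _⊠_; :-_ to ⊟_; con to κ)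

  module Expℚ = Algebra.Properties.CommutativeSemiring.Exp
    (CommutativeRing.commutativeSemiring ℚₚ.+-*-commutativeRing)

  open CommutativeRing series-commutativeRing
    using () renaming (setoid to series-setoid; refl to ≗-refl; sym to ≗-sym; trans to ≗-trans; +-cong to ⊕-cong; -‿cong to ⊖-cong)

  -- The derivation t d/dt, exponential series and rescaling of t

  θ : PowerSeries → PowerSeries
  θ f k = ι k * f k

  θ-⊛ : ∀ f g → θ (f ⊛ g) ≗ (θ f ⊛ g) ⊕ (f ⊛ θ g)
  θ-⊛ f g zero    = solve 2 (λ a b → con 0ℚ :* (a :* b :+ con 0ℚ)
      := con 0ℚ :* a :* b :+ con 0ℚ :+ (a :* (con 0ℚ :* b) :+ con 0ℚ)) refl (f 0) (g 0)
  θ-⊛ f g (suc n) = begin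
    ι (suc n) * (f 0 * g (suc n) + h)
      ≡⟨ solve 3 (λ i a h → i :* (a :+ h) := i :* a :+ i :* h) refl (ι (suc n)) (f 0 * g (suc n)) h ⟩
    ι (suc n) * (f 0 * g (suc n)) + ι (suc n) * h
      ≡⟨ cong (λ i → ι (suc n) * (f 0 * g (suc n)) + i * h) (ι-suc n) ⟩
    ι (suc n) * (f 0 * g (suc n)) + (1ℚ + ι n) * h
      ≡⟨ solve 3 (λ a i h → a :+ (con 1ℚ :+ i) :* h := a :+ (h :+ i :* h))
          refl (ι (suc n) * (f 0 * g (suc n))) (ι n) h ⟩
    ι (suc n) * (f 0 * g (suc n)) + (h + ι n * h)
      ≡⟨ cong (λ z → ι (suc n) * (f 0 * g (suc n)) + (h + z)) (θ-⊛ f′ g n) ⟩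
    ι (suc n) * (f 0 * g (suc n)) + (h + ((θ f′ ⊛ g) n + (f′ ⊛ θ g) n))
      ≡⟨ solve 6 (λ i a b h x y → i :* (a :* b) :+ (h :+ (x :+ y))
          := con 0ℚ :* a :* b :+ (h :+ x) :+ (a :* (i :* b) :+ y)) refl
           (ι (suc n)) (f 0) (g (suc n)) h ((θ f′ ⊛ g) n) ((f′ ⊛ θ g) n) ⟩
    θ f 0 * g (suc n) + (h + (θ f′ ⊛ g) n) + (f ⊛ θ g) (suc n)
      ≡⟨ cong (λ z → θ f 0 * g (suc n) + z + (f ⊛ θ g) (suc n))
          (trans (⊛-cong θ-tail (≗-refl {g}) n) (⊛-distribʳ g f′ (θ f′) n)) ⟨
    ((θ f ⊛ g) ⊕ (f ⊛ θ g)) (suc n) ∎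
    where
    open ≡-Reasoning
    f′ = f ∘ suc
    h = (f′ ⊛ g) n
    θ-tail : θ f ∘ suc ≗ f′ ⊕ θ f′
    θ-tail k = trans (cong (_* f′ k) (ι-suc k)) (solve 2 (λ i a → (con 1ℚ :+ i) :* a := a :+ i :* a)
        refl (ι k) (f′ k))

  CT-⊛ : ∀ a f → C a ⊛ T ⊛ f ≗ (λ k → a * (t· f) k)
  CT-⊛ a f n = trans (⊛-assoc (C a) T f n) (trans (C-⊛ a (T ⊛ f) n) (cong (a *_) (T-⊛ f n)))

  E : ℚ → PowerSeries
  E a = exp[ a t]

  θ-E : ∀ a → θ (E a) ≗ C a ⊛ T ⊛ E a
  θ-E a zero    = sym (trans (CT-⊛ a (E a) 0) (trans (ℚₚ.*-zeroʳ a) refl))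
  θ-E a (suc k) = sym (trans (CT-⊛ a (E a) (suc k)) (begin
    a * (a ^ k * recip (k !))                        ≡⟨ cong (λ z → a * (a ^ k * z)) (recip-suc! k) ⟨
    a * (a ^ k * (ι (suc k) * recip (suc k !)))      ≡⟨ solve 4 (λ a b c d → a :* (b :* (c :* d))
        := c :* (a :* b :* d)) refl a (a ^ k) (ι (suc k)) (recip (suc k !)) ⟩
    ι (suc k) * (a * a ^ k * recip (suc k !))        ∎))
    where open ≡-Reasoning

  -- The differential equation is a recurrence for the coefficients of f. This uniqueness replaces
  -- the binomial theorem in `E-⊛`.
  E-unique : ∀ a f → θ f ≗ C a ⊛ T ⊛ f → f 0 ≡ 1ℚ → f ≗ E a
  E-unique a f θf f₀ zero    = f₀
  E-unique a f θf f₀ (suc k) = ι-cancel (suc k) (begin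
    ι (suc k) * f (suc k)    ≡⟨ θf (suc k) ⟩
    (C a ⊛ T ⊛ f) (suc k)    ≡⟨ CT-⊛ a f (suc k) ⟩
    a * f k                  ≡⟨ cong (a *_) (E-unique a f θf f₀ k) ⟩
    a * E a k                ≡⟨ CT-⊛ a (E a) (suc k) ⟨
    (C a ⊛ T ⊛ E a) (suc k)  ≡⟨ θ-E a (suc k) ⟨
    ι (suc k) * E a (suc k)  ∎)
    where open ≡-Reasoning

  C-+ : ∀ a b → C (a + b) ≗ C a ⊕ C b
  C-+ a b zero    = refl
  C-+ a b (suc _) = refl

  E-⊛ : ∀ a b → E a ⊛ E b ≗ E (a + b)
  E-⊛ a b = E-unique (a + b) (E a ⊛ E b) eq refl
    where
    open import Relation.Binary.Reasoning.Setoid series-setoid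
    eq : θ (E a ⊛ E b) ≗ C (a + b) ⊛ T ⊛ (E a ⊛ E b)
    eq = begin
      θ (E a ⊛ E b)                                       ≈⟨ θ-⊛ (E a) (E b) ⟩
      (θ (E a) ⊛ E b) ⊕ (E a ⊛ θ (E b))                   ≈⟨ ⊕-cong (⊛-cong (θ-E a) (≗-refl {E b})) (⊛-cong (≗-refl {E a}) (θ-E b)) ⟩
      (C a ⊛ T ⊛ E a ⊛ E b) ⊕ (E a ⊛ (C b ⊛ T ⊛ E b))     ≈⟨ solveₛ 5 (λ a b t x y → a ⊠ t ⊠ x ⊠ y ⊞ x ⊠ (b ⊠ t ⊠ y)
          ≐ (a ⊞ b) ⊠ t ⊠ (x ⊠ y))
                                                                (λ _ → refl) (C a) (C b) T (E a) (E b) ⟩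
      (C a ⊕ C b) ⊛ T ⊛ (E a ⊛ E b)                       ≈⟨ ⊛-cong (⊛-cong (≗-sym (C-+ a b)) (≗-refl {T})) (≗-refl {E a ⊛ E b}) ⟩
      C (a + b) ⊛ T ⊛ (E a ⊛ E b)                         ∎

  E-0 : E 0ℚ ≗ 𝟏
  E-0 = ≗-sym (E-unique 0ℚ 𝟏 eq refl)
    where
    eq : θ 𝟏 ≗ C 0ℚ ⊛ T ⊛ 𝟏
    eq k = sym (trans (CT-⊛ 0ℚ 𝟏 k) (trans (ℚₚ.*-zeroˡ ((t· 𝟏) k)) (θ𝟏 k)))
      where
      θ𝟏 : ∀ k → 0ℚ ≡ θ 𝟏 k
      θ𝟏 zero    = refl
      θ𝟏 (suc k) = sym (ℚₚ.*-zeroʳ (ι (suc k)))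

  -- Substitution of ct for t.
  σ : ℚ → PowerSeries → PowerSeries
  σ c f k = c ^ k * f k

  σ-cong : ∀ c {f g} → f ≗ g → σ c f ≗ σ c g
  σ-cong c eq k = cong (c ^ k *_) (eq k)

  σ-⊛ : ∀ c f g → σ c (f ⊛ g) ≗ σ c f ⊛ σ c g
  σ-⊛ c f g zero    = solve 2 (λ a b → con 1ℚ :* (a :* b :+ con 0ℚ) := con 1ℚ :* a :* (con 1ℚ :* b) :+ con 0ℚ)
      refl (f 0) (g 0)
  σ-⊛ c f g (suc n) = begin
    c * c ^ n * (f 0 * g (suc n) + ((f ∘ suc) ⊛ g) n)
      ≡⟨ solve 5 (λ c cn a b h → c :* cn :* (a :* b :+ h) := con 1ℚ :* a :* (c :* cn :* b) :+ c :* (cn :* h)) refl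
           c (c ^ n) (f 0) (g (suc n)) (((f ∘ suc) ⊛ g) n) ⟩
    1ℚ * f 0 * (c * c ^ n * g (suc n)) + c * (c ^ n * ((f ∘ suc) ⊛ g) n)
      ≡⟨ cong (λ z → 1ℚ * f 0 * (c * c ^ n * g (suc n)) + c * z) (σ-⊛ c (f ∘ suc) g n) ⟩
    1ℚ * f 0 * (c * c ^ n * g (suc n)) + c * (σ c (f ∘ suc) ⊛ σ c g) n
      ≡⟨ cong (_+_ (1ℚ * f 0 * (c * c ^ n * g (suc n)))) (⊛-scale c (σ c (f ∘ suc)) (σ c g) n) ⟨
    1ℚ * f 0 * (c * c ^ n * g (suc n)) + ((λ k → c * σ c (f ∘ suc) k) ⊛ σ c g) n
      ≡⟨ cong (_+_ (1ℚ * f 0 * (c * c ^ n * g (suc n)))) (⊛-cong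
          (λ k → sym (ℚₚ.*-assoc c (c ^ k) (f (suc k)))) (≗-refl {σ c g}) n) ⟩
    (σ c f ⊛ σ c g) (suc n) ∎
    where open ≡-Reasoning

  σ-E : ∀ c a → σ c (E a) ≗ E (c * a)
  σ-E c a k = trans (sym (ℚₚ.*-assoc (c ^ k) (a ^ k) (recip (k !))))
                    (cong (_* recip (k !)) (sym (Expℚ.^-distrib-* c a k)))

  σ-t· : ∀ c f → σ c (t· f) ≗ (λ k → c * (t· σ c f) k)
  σ-t· c f zero    = sym (ℚₚ.*-zeroʳ c)
  σ-t· c f (suc k) = ℚₚ.*-assoc c (c ^ k) (f k)

  1^k≡1 : ∀ k → 1ℚ ^ k ≡ 1ℚ
  1^k≡1 zero    = refl
  1^k≡1 (suc k) = trans (ℚₚ.*-identityˡ _) (1^k≡1 k)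

  -- A polynomial f(y) of degree at most d is encoded by the series with r-th
  -- coefficient (d - r)! [y^(d - r)] f, for which the substitution y ↦ y + a is
  -- multiplication by e^(at), up to t^d. Under this encoding op d s turns f(y),
  -- of degree at most d - 1, into (y + s) f(y).
  op : ℚ → ℚ → PowerSeries → PowerSeries
  op d s f r = (d - ι r) * f r + s * (t· f) r

  -- (y + s)(y + s + 1) ⋯ (y + s + k - 1)
  rise : ℚ → ℕ → PowerSeries
  rise s zero    = 𝟏
  rise s (suc k) = op (ι (suc k)) (s + ι k) (rise s k)

  op-series : ∀ d s f → op d s f ≗ C d ⊛ f ⊕ ⊖ θ f ⊕ C s ⊛ T ⊛ f
  op-series d s f r = trans
    (solve 4 (λ d i a y → (d ⊝ i) :* a :+ y := d :* a :+ (:- (i :* a)) :+ y) refl d (ι r) (f r) (s * (t· f) r))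
    (sym (cong₂ (λ x y → x + - θ f r + y) (C-⊛ d f r) (CT-⊛ s f r)))

  t·-cong : ∀ {f g} → f ≗ g → t· f ≗ t· g
  t·-cong eq zero    = refl
  t·-cong eq (suc k) = eq k

  op-cong : ∀ d s {f g} → f ≗ g → op d s f ≗ op d s g
  op-cong d s eq r = cong₂ (λ x y → (d - ι r) * x + s * y) (eq r) (t·-cong eq r)

  -- At r = k + 1 the factor k + 1 - r is 0, so the coefficient of f beyond the range of agreement
  -- does not enter. This is why the range grows with the degree.
  op-cong-≤ : ∀ k s {f g} → (∀ r → r ℕ.≤ k → f r ≡ g r) →
    ∀ r → r ℕ.≤ suc k → op (ι (suc k)) s f r ≡ op (ι (suc k)) s g r
  op-cong-≤ k s {f} {g} eq zero    _  = cong (λ x → (ι (suc k) - 0ℚ) * x + s * 0ℚ) (eq 0 z≤n)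
  op-cong-≤ k s {f} {g} eq (suc r) (s≤s r≤k) with ℕₚ.m≤n⇒m<n∨m≡n r≤k
  ... | inj₁ r<k  = cong₂ (λ x y → (ι (suc k) - ι (suc r)) * x + s * y) (eq (suc r) r<k) (eq r r≤k)
  ... | inj₂ refl = cong₂ (λ x y → x + s * y) (trans (vanish (f (suc r))) (sym (vanish (g (suc r))))) (eq r r≤k)
    where
    vanish : ∀ x → (ι (suc r) - ι (suc r)) * x ≡ 0ℚ
    vanish = solve 2 (λ i x → (i ⊝ i) :* x := con 0ℚ) refl (ι (suc r))

  -- The commutation of e^(aD) with multiplication by y + s. In `op`, multiplication by y contains
  -- the derivation t d/dt; moving `E a` past it produces the additional summand a t.
  E-op : ∀ a d s f → E a ⊛ op d s f ≗ op d (s + a) (E a ⊛ f)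
  E-op a d s f = begin
    E a ⊛ op d s f
      ≈⟨ ⊛-cong (≗-refl {E a}) (op-series d s f) ⟩
    E a ⊛ (C d ⊛ f ⊕ ⊖ θ f ⊕ C s ⊛ T ⊛ f)
      ≈⟨ solveₛ 7 (λ e d f θf s a t → e ⊠ (d ⊠ f ⊞ ⊟ θf ⊞ s ⊠ t ⊠ f)
           ≐ d ⊠ (e ⊠ f) ⊞ ⊟ (a ⊠ t ⊠ e ⊠ f ⊞ e ⊠ θf) ⊞ (s ⊞ a) ⊠ t ⊠ (e ⊠ f))
           (λ _ → refl) (E a) (C d) f (θ f) (C s) (C a) T ⟩
    C d ⊛ (E a ⊛ f) ⊕ ⊖ (C a ⊛ T ⊛ E a ⊛ f ⊕ E a ⊛ θ f) ⊕ (C s ⊕ C a) ⊛ T ⊛ (E a ⊛ f)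
      ≈⟨ ⊕-cong (⊕-cong (≗-refl {C d ⊛ (E a ⊛ f)}) (⊖-cong θ-eq)) (⊛-cong (⊛-cong (C-+ s a) (≗-refl {T})) (≗-refl {E a ⊛ f})) ⟨
    C d ⊛ (E a ⊛ f) ⊕ ⊖ θ (E a ⊛ f) ⊕ C (s + a) ⊛ T ⊛ (E a ⊛ f)
      ≈⟨ op-series d (s + a) (E a ⊛ f) ⟨
    op d (s + a) (E a ⊛ f) ∎
    where
    open import Relation.Binary.Reasoning.Setoid series-setoid
    θ-eq : θ (E a ⊛ f) ≗ C a ⊛ T ⊛ E a ⊛ f ⊕ E a ⊛ θ f
    θ-eq = ≗-trans (θ-⊛ (E a) f) (⊕-cong (⊛-cong (θ-E a) (≗-refl {f})) (≗-refl {E a ⊛ θ f}))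

  -- Only up to t^k: the encoding of the constant 1 is 1, and e^(at) · 1 is 1 only up to t^0.
  E-rise : ∀ a s k r → r ℕ.≤ k → (E a ⊛ rise s k) r ≡ rise (s + a) k r
  E-rise a s zero    .0 z≤n = refl
  E-rise a s (suc k) r r≤ = begin
    (E a ⊛ rise s (suc k)) r                        ≡⟨ E-op a (ι (suc k)) (s + ι k) (rise s k) r ⟩
    op (ι (suc k)) (s + ι k + a) (E a ⊛ rise s k) r ≡⟨ op-cong-≤ k (s + ι k + a) (E-rise a s k) r r≤ ⟩
    op (ι (suc k)) (s + ι k + a) (rise (s + a) k) r ≡⟨ cong (λ x → op (ι (suc k)) x (rise (s + a) k) r)
                                                         (solve 3 (λ s k a → s :+ k :+ a
                                                             := s :+ a :+ k) refl s (ι k) a) ⟩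
    rise (s + a) (suc k) r                          ∎
    where open ≡-Reasoning

  op-comm : ∀ d s s′ f → op (1ℚ + d) s (op d s′ f) ≗ op (1ℚ + d) s′ (op d s f)
  op-comm d s s′ f zero = solve 4
      (λ d s s′ a → (con 1ℚ :+ d ⊝ con 0ℚ) :* ((d ⊝ con 0ℚ) :* a :+ s′ :* con 0ℚ) :+ s :* con 0ℚ
      := (con 1ℚ :+ d ⊝ con 0ℚ) :* ((d ⊝ con 0ℚ) :* a :+ s :* con 0ℚ) :+ s′ :* con 0ℚ) refl d s s′ (f 0)
  op-comm d s s′ f (suc r) rewrite ι-suc r =
    solve 7 (λ d s s′ i a b c → (con 1ℚ :+ d ⊝ (con 1ℚ :+ i)) :* ((d ⊝ (con 1ℚ :+ i)) :* a :+ s′ :* b) :+ s :* ((d ⊝ i) :* b :+ s′ :* c)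
      := (con 1ℚ :+ d ⊝ (con 1ℚ :+ i)) :* ((d ⊝ (con 1ℚ :+ i)) :* a :+ s :* b) :+ s′ :* ((d ⊝ i) :* b :+ s :* c))
      refl d s s′ (ι r) (f (suc r)) (f r) ((t· f) r)

  -- `rise` appends its largest factor y + s + k last. Here the smallest factor y + s is moved
  -- outwards past all the others.
  rise-left : ∀ s k → rise s (suc k) ≗ op (ι (suc k)) s (rise (s + 1ℚ) k)
  rise-left s zero    r = cong (λ x → op (ι 1) x 𝟏 r) (ℚₚ.+-identityʳ s)
  rise-left s (suc k) r = begin
    op (ι (2 ℕ.+ k)) (s + ι (suc k)) (rise s (suc k)) r
      ≡⟨ op-cong (ι (2 ℕ.+ k)) (s + ι (suc k)) (rise-left s k) r ⟩
    op (ι (2 ℕ.+ k)) (s + ι (suc k)) (op (ι (suc k)) s (rise (s + 1ℚ) k)) r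
      ≡⟨ cong₂ (λ x y → op x y (op (ι (suc k)) s (rise (s + 1ℚ) k)) r) (ι-suc (suc k))
           (trans (cong (_+_ s) (ι-suc k)) (sym (ℚₚ.+-assoc s 1ℚ (ι k)))) ⟩
    op (1ℚ + ι (suc k)) (s + 1ℚ + ι k) (op (ι (suc k)) s (rise (s + 1ℚ) k)) r
      ≡⟨ op-comm (ι (suc k)) (s + 1ℚ + ι k) s (rise (s + 1ℚ) k) r ⟩
    op (1ℚ + ι (suc k)) s (rise (s + 1ℚ) (suc k)) r
      ≡⟨ cong (λ x → op x s (rise (s + 1ℚ) (suc k)) r) (ι-suc (suc k)) ⟨
    op (ι (2 ℕ.+ k)) s (rise (s + 1ℚ) (suc k)) r ∎
    where open ≡-Reasoning

  -- Both products of k + 1 factors contain (y + s) ⋯ (y + s + k - 1); the remaining factors, y + s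
  -- + k and y + s - 1, differ by k + 1.
  rise-pascal : ∀ s k r → rise s (suc k) r ≡ rise (s - 1ℚ) (suc k) r + ι (suc k) * (t· rise s k) r
  rise-pascal s k r = begin
    rise s (suc k) r
      ≡⟨ cong (λ i → (ι (suc k) - ι r) * v + (s + i) * w) k≡ ⟩
    (ι (suc k) - ι r) * v + (s + (ι (suc k) - 1ℚ)) * w
      ≡⟨ solve 5 (λ i j v s w → (i ⊝ j) :* v :+ (s :+ (i ⊝ con 1ℚ)) :* w
          := (i ⊝ j) :* v :+ (s ⊝ con 1ℚ) :* w :+ i :* w) refl
           (ι (suc k)) (ι r) v s w ⟩
    op (ι (suc k)) (s - 1ℚ) (rise s k) r + ι (suc k) * w
      ≡⟨ cong (λ x → op (ι (suc k)) (s - 1ℚ) (rise x k) r + ι (suc k) * w) (solve 1 (λ s → s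
          := s ⊝ con 1ℚ :+ con 1ℚ) refl s) ⟩
    op (ι (suc k)) (s - 1ℚ) (rise (s - 1ℚ + 1ℚ) k) r + ι (suc k) * w
      ≡⟨ cong (_+ ι (suc k) * w) (rise-left (s - 1ℚ) k r) ⟨
    rise (s - 1ℚ) (suc k) r + ι (suc k) * w ∎
    where
    open ≡-Reasoning
    v = rise s k r
    w = (t· rise s k) r
    k≡ : ι k ≡ ι (suc k) - 1ℚ
    k≡ = trans (solve 1 (λ i → i := con 1ℚ :+ i ⊝ con 1ℚ) refl (ι k)) (cong (_- 1ℚ) (sym (ι-suc k)))

  -- On a polynomial with degree bound d, `σ (- 1ℚ)` is y ↦ - y together with the sign (-1)^d. One
  -- more factor flips that sign, so y + s becomes - (- y + s) = y - s.
  σ₋₁-op : ∀ d s f → σ (- 1ℚ) (op d s f) ≗ op d (- s) (σ (- 1ℚ) f)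
  σ₋₁-op d s f r = begin
    σ (- 1ℚ) (op d s f) r
      ≡⟨ solve 5 (λ e x a s b → e :* (x :* a :+ s :* b) := x :* (e :* a) :+ (:- s) :* (:- (e :* b))) refl
           ((- 1ℚ) ^ r) (d - ι r) (f r) s ((t· f) r) ⟩
    (d - ι r) * σ (- 1ℚ) f r + (- s) * - σ (- 1ℚ) (t· f) r
      ≡⟨ cong (λ x → (d - ι r) * σ (- 1ℚ) f r + (- s) * x)
           (trans (cong -_ (σ-t· (- 1ℚ) f r)) (solve 1 (λ x → :- (con (- 1ℚ) :* x) := x) refl ((t· σ (- 1ℚ) f) r))) ⟩
    op d (- s) (σ (- 1ℚ) f) r ∎
    where open ≡-Reasoning

  -- (-1)^k (1 - y)(2 - y) ⋯ (k - y) = (y - k) ⋯ (y - 2)(y - 1)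
  rise-reflect : ∀ k → σ (- 1ℚ) (rise 1ℚ k) ≗ rise (- ι k) k
  rise-reflect zero zero    = refl
  rise-reflect zero (suc r) = ℚₚ.*-zeroʳ ((- 1ℚ) ^ suc r)
  rise-reflect (suc k) r = begin
    σ (- 1ℚ) (rise 1ℚ (suc k)) r
      ≡⟨ σ₋₁-op (ι (suc k)) (1ℚ + ι k) (rise 1ℚ k) r ⟩
    op (ι (suc k)) (- (1ℚ + ι k)) (σ (- 1ℚ) (rise 1ℚ k)) r
      ≡⟨ op-cong (ι (suc k)) (- (1ℚ + ι k)) (rise-reflect k) r ⟩
    op (ι (suc k)) (- (1ℚ + ι k)) (rise (- ι k) k) r
      ≡⟨ cong₂ (λ x y → op (ι (suc k)) x (rise y k) r) (cong -_ (sym (ι-suc k)))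
           (trans (solve 1 (λ i → :- i := :- (con 1ℚ :+ i) :+ con 1ℚ)
               refl (ι k)) (cong (λ x → - x + 1ℚ) (sym (ι-suc k)))) ⟩
    op (ι (suc k)) (- ι (suc k)) (rise (- ι (suc k) + 1ℚ) k) r
      ≡⟨ rise-left (- ι (suc k)) k r ⟨
    rise (- ι (suc k)) (suc k) r ∎
    where open ≡-Reasoning

  -- The polynomial W

  -- The operator f(y) ↦ f(y + 1) + f(y - 1) - f(y) as a series in t = D. Its constant coefficient 1
  -- makes it invertible.
  X : PowerSeries
  X = E 1ℚ ⊕ E (- 1ℚ) ⊕ ⊖ 𝟏

  -- Encodes the binomial coefficient C(y + s + k - 1, k), of degree k in y.
  binom : ℚ → ℕ → PowerSeries
  binom s k r = recip (k !) * rise s k r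

  binom-pascal : ∀ s k r → binom s (suc k) r ≡ binom (s - 1ℚ) (suc k) r + (t· binom s k) r
  binom-pascal s k r = begin
    recip (suc k !) * rise s (suc k) r
      ≡⟨ cong (recip (suc k !) *_) (rise-pascal s k r) ⟩
    recip (suc k !) * (rise (s - 1ℚ) (suc k) r + ι (suc k) * (t· rise s k) r)
      ≡⟨ solve 4 (λ a b c d → a :* (b :+ c :* d) := a :* b :+ c :* a :* d) refl
           (recip (suc k !)) (rise (s - 1ℚ) (suc k) r) (ι (suc k)) ((t· rise s k) r) ⟩
    binom (s - 1ℚ) (suc k) r + ι (suc k) * recip (suc k !) * (t· rise s k) r
      ≡⟨ cong (λ x → binom (s - 1ℚ) (suc k) r + x * (t· rise s k) r) (recip-suc! k) ⟩
    binom (s - 1ℚ) (suc k) r + recip (k !) * (t· rise s k) r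
      ≡⟨ cong (_+_ (binom (s - 1ℚ) (suc k) r)) (t·-scale r) ⟩
    binom (s - 1ℚ) (suc k) r + (t· binom s k) r ∎
    where
    open ≡-Reasoning
    t·-scale : ∀ r → recip (k !) * (t· rise s k) r ≡ (t· binom s k) r
    t·-scale zero    = ℚₚ.*-zeroʳ (recip (k !))
    t·-scale (suc r) = refl

  X-binom : ∀ k r → r ℕ.≤ k → (X ⊛ binom 0ℚ k) r ≡ binom 1ℚ k r + binom (- 1ℚ) k r - binom 0ℚ k r
  X-binom k r r≤k = begin
    (X ⊛ binom 0ℚ k) r
      ≡⟨ ⊛-cong (≗-refl {X}) (≗-sym (C-⊛ k!⁻¹ v)) r ⟩
    (X ⊛ (C k!⁻¹ ⊛ v)) r
      ≡⟨ solveₛ 4 (λ x y c v → (x ⊞ y ⊞ ⊟ κ 1ℚ) ⊠ (c ⊠ v) ≐ c ⊠ (x ⊠ v ⊞ y ⊠ v ⊞ ⊟ v)) (λ _ → refl)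
           (E 1ℚ) (E (- 1ℚ)) (C k!⁻¹) v r ⟩
    (C k!⁻¹ ⊛ (E 1ℚ ⊛ v ⊕ E (- 1ℚ) ⊛ v ⊕ ⊖ v)) r
      ≡⟨ C-⊛ k!⁻¹ (E 1ℚ ⊛ v ⊕ E (- 1ℚ) ⊛ v ⊕ ⊖ v) r ⟩
    k!⁻¹ * ((E 1ℚ ⊛ v) r + (E (- 1ℚ) ⊛ v) r - v r)
      ≡⟨ cong₂ (λ a b → k!⁻¹ * (a + b - v r)) (E-rise 1ℚ 0ℚ k r r≤k) (E-rise (- 1ℚ) 0ℚ k r r≤k) ⟩
    k!⁻¹ * (rise 1ℚ k r + rise (- 1ℚ) k r - v r)
      ≡⟨ solve 4 (λ c a b d → c :* (a :+ b ⊝ d)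
          := c :* a :+ c :* b ⊝ c :* d) refl k!⁻¹ (rise 1ℚ k r) (rise (- 1ℚ) k r) (v r) ⟩
    binom 1ℚ k r + binom (- 1ℚ) k r - binom 0ℚ k r ∎
    where
    open ≡-Reasoning
    v = rise 0ℚ k
    k!⁻¹ = recip (k !)

  -- Encodes the coefficient of x^N in x (1 - x)^(-y) / (1 - x + x²), of degree at most N - 1 in y.
  w : ℕ → PowerSeries
  w zero          = 𝟎
  w (suc zero)    = 𝟏
  w (suc (suc N)) = t· w (suc N) ⊕ ⊖ t· t· w N ⊕ binom 0ℚ (suc N)

  -- Encodes the coefficient of x^N in x (1 - x)^(-y-1).
  X-w-target : ℕ → PowerSeries
  X-w-target zero    = 𝟎
  X-w-target (suc N) = binom 1ℚ N

  ⊛-t· : ∀ f g → f ⊛ t· g ≗ t· (f ⊛ g)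
  ⊛-t· f g = begin
    f ⊛ t· g      ≈⟨ ⊛-cong (≗-refl {f}) (T-⊛ g) ⟨
    f ⊛ (T ⊛ g)   ≈⟨ solveₛ 3 (λ f t g → f ⊠ (t ⊠ g) ≐ t ⊠ (f ⊠ g)) (λ _ → refl) f T g ⟩
    T ⊛ (f ⊛ g)   ≈⟨ T-⊛ (f ⊛ g) ⟩
    t· (f ⊛ g)    ∎
    where open import Relation.Binary.Reasoning.Setoid series-setoid

  t·-cong-< : ∀ N {f g} → (∀ r → r ℕ.< N → f r ≡ g r) → ∀ r → r ℕ.< suc N → (t· f) r ≡ (t· g) r
  t·-cong-< N eq zero    _         = refl
  t·-cong-< N eq (suc r) (s≤s r<N) = eq r r<N

  -- The cancellation of 1 - x + x², coefficient by coefficient. The recurrence of `w` contributes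
  -- the shifted terms a and - b; Pascal's rule, used twice, expresses `binom 0ℚ (suc N)` through
  -- `binom (- 1ℚ) (suc N)`, a and b, and only `binom 1ℚ (suc N)` is left. The bound on r comes from
  -- `E-rise`.
  X-w : ∀ N r → r ℕ.< N → (X ⊛ w N) r ≡ X-w-target N r
  X-w (suc zero)    zero    _ = refl
  X-w (suc zero)    (suc r) (s≤s ())
  X-w (suc (suc N)) r r<N = begin
    (X ⊛ w (2 ℕ.+ N)) r
      ≡⟨ solveₛ 4 (λ x a b c → x ⊠ (a ⊞ ⊟ b ⊞ c) ≐ x ⊠ a ⊞ ⊟ (x ⊠ b) ⊞ x ⊠ c) (λ _ → refl)
           X (t· w (suc N)) (t· t· w N) (binom 0ℚ (suc N)) r ⟩
    (X ⊛ t· w (suc N)) r + - (X ⊛ t· t· w N) r + (X ⊛ binom 0ℚ (suc N)) r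
      ≡⟨ cong₂ (λ x y → x + - y + (X ⊛ binom 0ℚ (suc N)) r)
           (trans (⊛-t· X (w (suc N)) r) (t·-cong-< (suc N) (X-w (suc N)) r r<N))
           (trans (⊛-t· X (t· w N) r)
               (trans (t·-cong (⊛-t· X (w N)) r) (t·-cong-< (suc N) (t·-cong-< N (X-w N)) r r<N))) ⟩
    a + - b + (X ⊛ binom 0ℚ (suc N)) r
      ≡⟨ cong (_+_ (a + - b)) (X-binom (suc N) r (ℕₚ.≤-pred r<N)) ⟩
    a + - b + (c + binom (- 1ℚ) (suc N) r - binom 0ℚ (suc N) r)
      ≡⟨ cong (λ x → a + - b + (c + binom (- 1ℚ) (suc N) r - x)) (trans (binom-pascal 0ℚ N r)
          (cong (_+_ (binom (- 1ℚ) (suc N) r)) (pascal₂ N r))) ⟩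
    a + - b + (c + binom (- 1ℚ) (suc N) r - (binom (- 1ℚ) (suc N) r + (a - b)))
      ≡⟨ solve 4 (λ a b c d → a :+ (:- b) :+ (c :+ d ⊝ (d :+ (a ⊝ b))) := c) refl a b c (binom (- 1ℚ) (suc N) r) ⟩
    c ∎
    where
    open ≡-Reasoning
    a = (t· binom 1ℚ N) r
    b = (t· t· X-w-target N) r
    c = binom 1ℚ (suc N) r
    pascal₁ : ∀ N r → binom 0ℚ N r ≡ binom 1ℚ N r - (t· X-w-target N) r
    pascal₁ zero    zero          = refl
    pascal₁ zero    (suc zero)    = refl
    pascal₁ zero    (suc (suc r)) = refl
    pascal₁ (suc N) r = trans (solve 2 (λ a b → a := a :+ b ⊝ b) refl (binom 0ℚ (suc N) r) ((t· binom 1ℚ N) r))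
                              (cong (_- (t· binom 1ℚ N) r) (sym (binom-pascal 1ℚ N r)))
    pascal₂ : ∀ N r → (t· binom 0ℚ N) r ≡ (t· binom 1ℚ N) r - (t· t· X-w-target N) r
    pascal₂ N zero    = refl
    pascal₂ N (suc r) = pascal₁ N r

  -- Multiple harmonic sums

  ∑-cong-< : ∀ p {f g} → (∀ k → suc k ℕ.< p → f (suc k) ≡ g (suc k)) → ∑₀﹤ₖ﹤ₚ p f ≡ ∑₀﹤ₖ﹤ₚ p g
  ∑-cong-< zero    eq = refl
  ∑-cong-< (suc p) eq = Sumℚ.sum-cong-≗ {p} (λ i → eq (toℕ i) (s≤s (Finₚ.toℕ<n i)))

  ∑-suc : ∀ p f → ∑₀﹤ₖ﹤ₚ (2 ℕ.+ p) f ≡ ∑₀﹤ₖ﹤ₚ (suc p) f + f (suc p)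
  ∑-suc p f = trans (Sumℚ.sum-init-last {p} (λ i → f (suc (toℕ i))))
    (cong₂ _+_ (Sumℚ.sum-cong-≗ {p} (λ i → cong (f ∘ suc) (Finₚ.toℕ-inject₁ i))) (cong (f ∘ suc) (Finₚ.toℕ-fromℕ p)))

  ∑-scale : ∀ p a f → ∑₀﹤ₖ﹤ₚ p (λ k → a * f k) ≡ a * ∑₀﹤ₖ﹤ₚ p f
  ∑-scale p a f = sym (Sumℚ.*-distribˡ-sum {p ∸ 1} a (λ i → f (suc (toℕ i))))

  ∑-increasing-cong : ∀ n p {F G : Vec ℕ n → ℚ} → F ≗ G → ∑-increasing n p F ≡ ∑-increasing n p G
  ∑-increasing-cong zero    p eq = eq []
  ∑-increasing-cong (suc n) p {F} {G} eq = ∑-cong-< p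
    {λ k → ∑-increasing n k (λ ks → F (ks ∷ʳ k))} {λ k → ∑-increasing n k (λ ks → G (ks ∷ʳ k))}
    (λ k _ → ∑-increasing-cong n (suc k) (λ ks → eq (ks ∷ʳ suc k)))

  ∑-increasing-scale : ∀ n p a F → ∑-increasing n p (λ ks → a * F ks) ≡ a * ∑-increasing n p F
  ∑-increasing-scale zero    p a F = refl
  ∑-increasing-scale (suc n) p a F = trans
    (∑-cong-< p {λ k → ∑-increasing n k (λ ks → a * F (ks ∷ʳ k))} {λ k → a * ∑-increasing n k (λ ks → F (ks ∷ʳ k))}
      (λ k _ → ∑-increasing-scale n (suc k) a (λ ks → F (ks ∷ʳ suc k))))
    (∑-scale p a (λ k → ∑-increasing n k (λ ks → F (ks ∷ʳ k))))

  -- The dummy value `recip 0` = 0 is multiplicative too. So summands can be rewritten for arbitrary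
  -- vectors, as `∑-increasing-cong` demands, not only for vectors of positive numbers.
  recip-*′ : ∀ m n → recip (m ℕ.* n) ≡ recip m * recip n
  recip-*′ zero    n       = sym (ℚₚ.*-zeroˡ (recip n))
  recip-*′ (suc m) zero    = trans (cong recip (ℕₚ.*-zeroʳ m)) (sym (ℚₚ.*-zeroʳ (recip (suc m))))
  recip-*′ (suc m) (suc n) = recip-* (suc m) (suc n)

  product : ∀ {n} → Vec ℕ n → ℕ
  product = foldr′ ℕ._*_ 1

  product-∷ʳ : ∀ {n} (ks : Vec ℕ n) k → product (ks ∷ʳ k) ≡ k ℕ.* product ks
  product-∷ʳ []       k = refl
  product-∷ʳ (j ∷ ks) k = begin
    j ℕ.* product (ks ∷ʳ k)    ≡⟨ cong (j ℕ.*_) (product-∷ʳ ks k) ⟩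
    j ℕ.* (k ℕ.* product ks)   ≡⟨ ℕₚ.*-assoc j k (product ks) ⟨
    j ℕ.* k ℕ.* product ks     ≡⟨ cong (ℕ._* product ks) (ℕₚ.*-comm j k) ⟩
    k ℕ.* j ℕ.* product ks     ≡⟨ ℕₚ.*-assoc k j (product ks) ⟩
    k ℕ.* (j ℕ.* product ks)   ∎
    where open ≡-Reasoning

  harmonic : ℕ → ℕ → ℚ
  harmonic k m = ∑-increasing m k (λ ks → recip (product ks))

  harmonic-unfold : ∀ k m → harmonic k (suc m) ≡ ∑₀﹤ₖ﹤ₚ k (λ j → recip j * harmonic j m)
  harmonic-unfold k m = ∑-cong-< k {λ j → ∑-increasing m j
      (λ ks → recip (product (ks ∷ʳ j)))} {λ j → recip j * harmonic j m} (λ j _ → trans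
    (∑-increasing-cong m (suc j) (λ ks → trans (cong recip (product-∷ʳ ks (suc j))) (recip-*′ (suc j) (product ks))))
    (∑-increasing-scale m (suc j) (recip (suc j)) (λ ks → recip (product ks))))

  harmonic-suc : ∀ k m → harmonic (2 ℕ.+ k) (suc m) ≡ harmonic (suc k) (suc m) + recip (suc k) * harmonic (suc k) m
  harmonic-suc k m = trans (harmonic-unfold (2 ℕ.+ k) m)
    (trans (∑-suc k (λ j → recip j * harmonic j m))
           (cong (_+ recip (suc k) * harmonic (suc k) m) (sym (harmonic-unfold (suc k) m))))

  ∑-zero : ∀ p {f} → (∀ k → suc k ℕ.< p → f (suc k) ≡ 0ℚ) → ∑₀﹤ₖ﹤ₚ p f ≡ 0ℚ
  ∑-zero p {f} eq = trans (∑-cong-< p {f} {λ k → 0ℚ * f k} (λ k k<p → trans (eq k k<p)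
      (sym (ℚₚ.*-zeroˡ (f (suc k))))))
                          (trans (∑-scale p 0ℚ f) (ℚₚ.*-zeroˡ (∑₀﹤ₖ﹤ₚ p f)))

  harmonic-vanish : ∀ k m → suc k ℕ.≤ m → harmonic (suc k) m ≡ 0ℚ
  harmonic-vanish k (suc m) (s≤s k≤m) = trans (harmonic-unfold (suc k) m) (∑-zero (suc k) {λ j → recip j * harmonic j m} (λ j j<k → trans
    (cong (recip (suc j) *_) (harmonic-vanish j m (ℕₚ.≤-trans (ℕₚ.≤-pred j<k) k≤m))) (ℚₚ.*-zeroʳ (recip (suc j)))))

  rise-suc : ∀ s k r n → r ℕ.+ n ≡ suc k →
    rise s (suc k) r ≡ ι n * rise s k r + (s + ι k) * (t· rise s k) r
  rise-suc s k r n r+n = cong (λ x → x * rise s k r + (s + ι k) * (t· rise s k) r) (begin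
    ι (suc k) - ι r      ≡⟨ cong (λ x → ι x - ι r) r+n ⟨
    ι (r ℕ.+ n) - ι r    ≡⟨ cong (_- ι r) (ι-+ r n) ⟩
    ι r + ι n - ι r      ≡⟨ solve 2 (λ r n → r :+ n ⊝ r := n) refl (ι r) (ι n) ⟩
    ι n                  ∎)
    where open ≡-Reasoning

  ι-!-suc : ∀ n → ι (suc n !) ≡ ι (suc n) * ι (n !)
  ι-!-suc n = ι-* (suc n) (n !)

  -- (y + 1) ⋯ (y + k) is k! times the product of 1 + y / j over 0 < j ≤ k, and expanding that
  -- product chooses n of the indices for y^n. The factor n! belongs to the encoding.
  rise₁-harmonic : ∀ k r n → r ℕ.+ n ≡ k → rise 1ℚ k r ≡ ι (k !) * (ι (n !) * harmonic (suc k) n)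
  rise₁-harmonic zero    zero zero    refl = refl
  rise₁-harmonic (suc k) r    n       r+n  = begin
    rise 1ℚ (suc k) r
      ≡⟨ rise-suc 1ℚ k r n r+n ⟩
    ι n * rise 1ℚ k r + (1ℚ + ι k) * (t· rise 1ℚ k) r
      ≡⟨ cong₂ (λ x y → ι n * rise 1ℚ k r + x * y) (sym (ι-suc k)) (shifted r r+n) ⟩
    ι n * rise 1ℚ k r + ι (suc k) * (ι (k !) * (ι (n !) * harmonic (suc k) n))
      ≡⟨ combine n r+n ⟩
    ι (suc k !) * (ι (n !) * harmonic (2 ℕ.+ k) n) ∎
    where
    open ≡-Reasoning
    shifted : ∀ r → r ℕ.+ n ≡ suc k → (t· rise 1ℚ k) r ≡ ι (k !) * (ι (n !) * harmonic (suc k) n)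
    -- Here n = k + 1 exceeds the number of available indices, so the harmonic sum is empty.
    shifted zero    eq = sym (trans (cong (λ x → ι (k !) * (ι (n !) * x)) (harmonic-vanish k n (ℕₚ.≤-reflexive
        (sym eq))))
                                    (solve 2 (λ a b → a :* (b :* con 0ℚ) := con 0ℚ) refl (ι (k !)) (ι (n !))))
    shifted (suc r) eq = rise₁-harmonic k r n (ℕₚ.suc-injective eq)
    combine : ∀ n → r ℕ.+ n ≡ suc k →
      ι n * rise 1ℚ k r + ι (suc k) * (ι (k !) * (ι (n !) * harmonic (suc k) n)) ≡
      ι (suc k !) * (ι (n !) * harmonic (2 ℕ.+ k) n)
    combine zero    eq = trans (solve 3 (λ v a b → con 0ℚ :* v :+ a :* (b :* (con 1ℚ :* con 1ℚ))
        := a :* b :* (con 1ℚ :* con 1ℚ)) refl (rise 1ℚ k r) (ι (suc k)) (ι (k !)))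
                               (cong (_* (1ℚ * 1ℚ)) (sym (ι-!-suc k)))
    combine (suc n) eq = begin
      ι (suc n) * rise 1ℚ k r + ι (suc k) * (ι (k !) * (ι (suc n !) * H))
        ≡⟨ cong₂ (λ x y → ι (suc n) * x + ι (suc k) * (ι (k !) * (y * H)))
             (rise₁-harmonic k r n (ℕₚ.suc-injective (trans (sym (ℕₚ.+-suc r n)) eq))) (ι-!-suc n) ⟩
      ι (suc n) * (ι (k !) * (ι (n !) * H′)) + ι (suc k) * (ι (k !) * (ι (suc n) * ι (n !) * H))
        ≡⟨ cong (λ x → ι (suc n) * (ι (k !) * (ι (n !) * x)) + ι (suc k) * (ι (k !) * (ι (suc n) * ι (n !) * H))) H′≡ ⟩
      ι (suc n) * (ι (k !) * (ι (n !) * (ι (suc k) * (R * H′)))) + ι (suc k) * (ι (k !) * (ι (suc n) * ι (n !) * H))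
        ≡⟨ solve 6 (λ a b c d e f → a :* (b :* (c :* (d :* e))) :+ d :* (b :* (a :* c :* f))
            := d :* b :* (a :* c :* (f :+ e))) refl
             (ι (suc n)) (ι (k !)) (ι (n !)) (ι (suc k)) (R * H′) H ⟩
      ι (suc k) * ι (k !) * (ι (suc n) * ι (n !) * (H + R * H′))
        ≡⟨ cong₂ (λ x y → x * (y * (H + R * H′))) (ι-!-suc k) (ι-!-suc n) ⟨
      ι (suc k !) * (ι (suc n !) * (H + R * H′))
        ≡⟨ cong (λ x → ι (suc k !) * (ι (suc n !) * x)) (harmonic-suc k n) ⟨
      ι (suc k !) * (ι (suc n !) * harmonic (2 ℕ.+ k) (suc n)) ∎
      where
      H H′ R : ℚ
      H = harmonic (suc k) (suc n)
      H′ = harmonic (suc k) n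
      R = recip (suc k)
      H′≡ : H′ ≡ ι (suc k) * (R * H′)
      H′≡ = begin
        H′                       ≡⟨ ℚₚ.*-identityˡ H′ ⟨
        1ℚ * H′                  ≡⟨ cong (_* H′) (recip-cancel (suc k)) ⟨
        R * ι (suc k) * H′       ≡⟨ solve 3 (λ a b c → a :* b :* c := b :* (a :* c)) refl R (ι (suc k)) H′ ⟩
        ι (suc k) * (R * H′)     ∎

  -- The polynomial is y / (k + 1) times the product of 1 + y / j over 0 < j ≤ k: the leading factor
  -- uses up one power of y and fixes the last index at k + 1.
  binom₀-harmonic : ∀ k r n → r ℕ.+ suc n ≡ suc k →
    binom 0ℚ (suc k) r ≡ ι (suc n !) * (recip (suc k) * harmonic (suc k) n)
  binom₀-harmonic k r n r+n = begin
    recip (suc k !) * rise 0ℚ (suc k) r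
      ≡⟨ cong (recip (suc k !) *_) (rise-left 0ℚ k r) ⟩
    recip (suc k !) * ((ι (suc k) - ι r) * rise 1ℚ k r + 0ℚ * (t· rise 1ℚ k) r)
      ≡⟨ cong₂ (λ x y → recip (suc k !) * (x * y + 0ℚ * (t· rise 1ℚ k) r)) diff
           (rise₁-harmonic k r n (ℕₚ.suc-injective (trans (sym (ℕₚ.+-suc r n)) r+n))) ⟩
    recip (suc k !) * (ι (suc n) * (ι (k !) * (ι (n !) * H)) + 0ℚ * (t· rise 1ℚ k) r)
      ≡⟨ cong (_* (ι (suc n) * (ι (k !) * (ι (n !) * H)) + 0ℚ * (t· rise 1ℚ k) r)) (recip-* (suc k) (k !) {{_}} {{ℕₚ._!≢0 k}}) ⟩
    recip (suc k) * recip (k !) * (ι (suc n) * (ι (k !) * (ι (n !) * H)) + 0ℚ * (t· rise 1ℚ k) r)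
      ≡⟨ solve 7 (λ a b c d e f z → a :* b :* (c :* (d :* (e :* f)) :+ con 0ℚ :* z)
          := b :* d :* (c :* e :* (a :* f))) refl
           (recip (suc k)) (recip (k !)) (ι (suc n)) (ι (k !)) (ι (n !)) H ((t· rise 1ℚ k) r) ⟩
    recip (k !) * ι (k !) * (ι (suc n) * ι (n !) * (recip (suc k) * H))
      ≡⟨ cong₂ (λ x y → x * (y * (recip (suc k) * H))) (recip-cancel (k !) {{ℕₚ._!≢0 k}}) (sym (ι-!-suc n)) ⟩
    1ℚ * (ι (suc n !) * (recip (suc k) * H))
      ≡⟨ ℚₚ.*-identityˡ _ ⟩
    ι (suc n !) * (recip (suc k) * H) ∎
    where
    open ≡-Reasoning
    H = harmonic (suc k) n
    diff : ι (suc k) - ι r ≡ ι (suc n)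
    diff = begin
      ι (suc k) - ι r          ≡⟨ cong (λ x → ι x - ι r) r+n ⟨
      ι (r ℕ.+ suc n) - ι r    ≡⟨ cong (_- ι r) (ι-+ r (suc n)) ⟩
      ι r + ι (suc n) - ι r    ≡⟨ solve 2 (λ r n → r :+ n ⊝ r := n) refl (ι r) (ι (suc n)) ⟩
      ι (suc n)                ∎

  ℓ : ℕ → ℚ
  ℓ j = ιᶻ (legendre₃ (ℤ.+ j))

  ℓ-sum : ∀ j → ℓ (2 ℕ.+ j) + ℓ (1 ℕ.+ j) + ℓ j ≡ 0ℚ
  ℓ-sum zero                = refl
  ℓ-sum (suc zero)          = refl
  ℓ-sum (suc (suc zero))    = refl
  ℓ-sum (suc (suc (suc j))) = ℓ-sum j

  -- The coefficients of x / (1 - x + x²)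
  U : ℕ → ℚ
  U j = - (ℓ j * (- 1ℚ) ^ j)

  U-suc-suc : ∀ j → U (2 ℕ.+ j) ≡ U (suc j) - U j
  U-suc-suc j = begin
    - (a * (- 1ℚ * (- 1ℚ * e)))
      ≡⟨ solve 4 (λ a b c e → :- (a :* (con (- 1ℚ) :* (con (- 1ℚ) :* e)))
          := :- (b :* (con (- 1ℚ) :* e)) ⊝ (:- (c :* e)) ⊝ (a :+ b :+ c) :* e)
           refl a b c e ⟩
    U (suc j) - U j - (a + b + c) * e
      ≡⟨ cong (λ x → U (suc j) - U j - x * e) (ℓ-sum j) ⟩
    U (suc j) - U j - 0ℚ * e
      ≡⟨ solve 2 (λ x e → x ⊝ con 0ℚ :* e := x) refl (U (suc j) - U j) e ⟩
    U (suc j) - U j ∎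
    where
    open ≡-Reasoning
    a = ℓ (2 ℕ.+ j)
    b = ℓ (1 ℕ.+ j)
    c = ℓ j
    e = (- 1ℚ) ^ j

  -- The left-hand side for n = m + 1, with N in place of p, grouped by the last index. As a
  -- convolution it is the coefficient of x^N in a product with x / (1 - x + x²).
  U-sum : ℕ → ℕ → ℚ
  U-sum N m = ∑₀﹤ₖ﹤ₚ N (λ k → U (N ∸ k) * (recip k * harmonic k m))

  U-sum-vanish : ∀ N m → N ℕ.≤ suc m → U-sum N m ≡ 0ℚ
  U-sum-vanish N m N≤ = ∑-zero N {λ k → U (N ∸ k) * (recip k * harmonic k m)} (λ k k<N → trans
    (cong (λ x → U (N ∸ suc k) * (recip (suc k) * x)) (harmonic-vanish k m (ℕₚ.≤-pred (ℕₚ.≤-trans k<N N≤))))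
    (solve 2 (λ a b → a :* (b :* con 0ℚ) := con 0ℚ) refl (U (N ∸ suc k)) (recip (suc k))))

  ∑-minus : ∀ p f g → ∑₀﹤ₖ﹤ₚ p (λ k → f k - g k) ≡ ∑₀﹤ₖ﹤ₚ p f - ∑₀﹤ₖ﹤ₚ p g
  ∑-minus zero          f g = refl
  ∑-minus (suc zero)    f g = refl
  ∑-minus (suc (suc p)) f g = begin
    ∑₀﹤ₖ﹤ₚ (2 ℕ.+ p) (λ k → f k - g k)
      ≡⟨ ∑-suc p (λ k → f k - g k) ⟩
    ∑₀﹤ₖ﹤ₚ (suc p) (λ k → f k - g k) + (f (suc p) - g (suc p))
      ≡⟨ cong (_+ (f (suc p) - g (suc p))) (∑-minus (suc p) f g) ⟩
    ∑₀﹤ₖ﹤ₚ (suc p) f - ∑₀﹤ₖ﹤ₚ (suc p) g + (f (suc p) - g (suc p))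
      ≡⟨ solve 4 (λ a b c d → a ⊝ b :+ (c ⊝ d) := a :+ c ⊝ (b :+ d))
          refl (∑₀﹤ₖ﹤ₚ (suc p) f) (∑₀﹤ₖ﹤ₚ (suc p) g) (f (suc p)) (g (suc p)) ⟩
    ∑₀﹤ₖ﹤ₚ (suc p) f + f (suc p) - (∑₀﹤ₖ﹤ₚ (suc p) g + g (suc p))
      ≡⟨ cong₂ _-_ (∑-suc p f) (∑-suc p g) ⟨
    ∑₀﹤ₖ﹤ₚ (2 ℕ.+ p) f - ∑₀﹤ₖ﹤ₚ (2 ℕ.+ p) g ∎
    where open ≡-Reasoning

  U-sum-suc-suc : ∀ N m → U-sum (2 ℕ.+ N) m ≡ U-sum (suc N) m - U-sum N m + recip (suc N) * harmonic (suc N) m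
  U-sum-suc-suc N m = begin
    U-sum (2 ℕ.+ N) m
      ≡⟨ ∑-suc N (λ k → U (2 ℕ.+ N ∸ k) * d k) ⟩
    ∑₀﹤ₖ﹤ₚ (suc N) (λ k → U (2 ℕ.+ N ∸ k) * d k) + U (suc N ∸ N) * d (suc N)
      ≡⟨ cong₂ _+_ (∑-cong-< (suc N) {λ k → U (2 ℕ.+ N ∸ k) * d k} {λ k → U (suc N ∸ k) * d k - U (N ∸ k) * d k}
          (λ k k<N → split k (ℕₚ.≤-pred k<N)))
                   (trans (cong (λ j → U j * d (suc N)) (ℕₚ.m+n∸n≡m 1 N)) (ℚₚ.*-identityˡ (d (suc N)))) ⟩
    ∑₀﹤ₖ﹤ₚ (suc N) (λ k → U (suc N ∸ k) * d k - U (N ∸ k) * d k) + d (suc N)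
      ≡⟨ cong (_+ d (suc N)) (∑-minus (suc N) (λ k → U (suc N ∸ k) * d k) (λ k → U (N ∸ k) * d k)) ⟩
    U-sum (suc N) m - ∑₀﹤ₖ﹤ₚ (suc N) (λ k → U (N ∸ k) * d k) + d (suc N)
      ≡⟨ cong (λ x → U-sum (suc N) m - x + d (suc N)) (drop-last N) ⟩
    U-sum (suc N) m - U-sum N m + d (suc N) ∎
    where
    open ≡-Reasoning
    d : ℕ → ℚ
    d k = recip k * harmonic k m
    split : ∀ k → suc k ℕ.≤ N →
      U (suc N ∸ k) * d (suc k) ≡ U (N ∸ k) * d (suc k) - U (N ∸ suc k) * d (suc k)
    split k k≤N = begin
      U (suc N ∸ k) * d (suc k)
        ≡⟨ cong (λ j → U j * d (suc k)) (trans (ℕₚ.+-∸-assoc 2 k≤N) refl) ⟩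
      U (2 ℕ.+ (N ∸ suc k)) * d (suc k)
        ≡⟨ cong (_* d (suc k)) (U-suc-suc (N ∸ suc k)) ⟩
      (U (suc (N ∸ suc k)) - U (N ∸ suc k)) * d (suc k)
        ≡⟨ cong (λ j → (U j - U (N ∸ suc k)) * d (suc k)) (ℕₚ.+-∸-assoc 1 k≤N) ⟨
      (U (N ∸ k) - U (N ∸ suc k)) * d (suc k)
        ≡⟨ solve 3 (λ a b c → (a ⊝ b) :* c := a :* c ⊝ b :* c) refl (U (N ∸ k)) (U (N ∸ suc k)) (d (suc k)) ⟩
      U (N ∸ k) * d (suc k) - U (N ∸ suc k) * d (suc k) ∎
    drop-last : ∀ N → ∑₀﹤ₖ﹤ₚ (suc N) (λ k → U (N ∸ k) * d k) ≡ ∑₀﹤ₖ﹤ₚ N (λ k → U (N ∸ k) * d k)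
    drop-last zero    = refl
    drop-last (suc N) = trans (∑-suc N (λ k → U (suc N ∸ k) * d k))
      (trans (cong (λ j → U-sum (suc N) m + U j * d (suc N)) (ℕₚ.n∸n≡0 N))
             (solve 2 (λ a b → a :+ con 0ℚ :* b := a) refl (U-sum (suc N) m) (d (suc N))))

  -- Both sides obey the same recurrence in N. The three statements are mutual because `t·_` shifts
  -- r; where r runs out, the sum on the right has too few indices and vanishes.
  w-U-sum : ∀ N r m → r ℕ.+ suc m ≡ N → w (suc N) r ≡ ι (suc m !) * U-sum (suc N) m
  t·w-U-sum : ∀ N r m → r ℕ.+ suc m ≡ suc N → (t· w (suc N)) r ≡ ι (suc m !) * U-sum (suc N) m
  t·t·w-U-sum : ∀ N r m → r ℕ.+ suc m ≡ suc N → (t· t· w N) r ≡ ι (suc m !) * U-sum N m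

  w-U-sum zero    zero    m ()
  w-U-sum zero    (suc r) m ()
  w-U-sum (suc N) r m r+m = begin
    (t· w (suc N)) r + - (t· t· w N) r + binom 0ℚ (suc N) r
      ≡⟨ cong₂ (λ x y → x + - y + binom 0ℚ (suc N) r) (t·w-U-sum N r m r+m) (t·t·w-U-sum N r m r+m) ⟩
    ι (suc m !) * U-sum (suc N) m + - (ι (suc m !) * U-sum N m) + binom 0ℚ (suc N) r
      ≡⟨ cong (_+_ (ι (suc m !) * U-sum (suc N) m + - (ι (suc m !) * U-sum N m))) (binom₀-harmonic N r m r+m) ⟩
    ι (suc m !) * U-sum (suc N) m + - (ι (suc m !) * U-sum N m) + ι (suc m !) * (recip (suc N) * harmonic (suc N) m)
      ≡⟨ solve 4 (λ i a b c → i :* a :+ (:- (i :* b)) :+ i :* c := i :* (a ⊝ b :+ c)) refl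
           (ι (suc m !)) (U-sum (suc N) m) (U-sum N m) (recip (suc N) * harmonic (suc N) m) ⟩
    ι (suc m !) * (U-sum (suc N) m - U-sum N m + recip (suc N) * harmonic (suc N) m)
      ≡⟨ cong (ι (suc m !) *_) (U-sum-suc-suc N m) ⟨
    ι (suc m !) * U-sum (2 ℕ.+ N) m ∎
    where open ≡-Reasoning

  t·w-U-sum N zero    m eq = sym (trans (cong (ι (suc m !) *_) (U-sum-vanish (suc N) m (ℕₚ.≤-reflexive
      (sym eq)))) (ℚₚ.*-zeroʳ (ι (suc m !))))
  t·w-U-sum N (suc r) m eq = w-U-sum N r m (ℕₚ.suc-injective eq)

  t·t·w-U-sum N zero    m eq = sym (trans (cong (ι (suc m !) *_) (U-sum-vanish N m (ℕₚ.≤-trans (ℕₚ.n≤1+n N)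
      (ℕₚ.≤-reflexive (sym eq))))) (ℚₚ.*-zeroʳ (ι (suc m !))))
  t·t·w-U-sum N (suc zero) m eq = trans (w₀ N) (sym (trans (cong (ι (suc m !) *_) (U-sum-vanish N m (ℕₚ.≤-reflexive
      (sym (ℕₚ.suc-injective eq))))) (ℚₚ.*-zeroʳ (ι (suc m !)))))
    where
    w₀ : ∀ N → (t· w N) 0 ≡ 0ℚ
    w₀ N = refl
  t·t·w-U-sum zero    (suc (suc r)) m ()
  t·t·w-U-sum (suc N) (suc (suc r)) m eq = w-U-sum N r m (ℕₚ.suc-injective (ℕₚ.suc-injective eq))

  -1*-1^ : ∀ j → (- 1ℚ) ^ j * (- 1ℚ) ^ j ≡ 1ℚ
  -1*-1^ zero    = refl
  -1*-1^ (suc j) = trans (solve 1 (λ e → con (- 1ℚ) :* e :* (con (- 1ℚ) :* e) := e :* e) refl ((- 1ℚ) ^ j)) (-1*-1^ j)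

  -- As p is odd, (-1)^k = - (-1)^(p - k), so symbol and sign of a summand combine to `U (p ∸ k)`.
  -- The index r is p - 1 - n for n = m + 1, and the factor n! is that of the encoding.
  legendreSum-w : ∀ p m r → (- 1ℚ) ^ p ≡ - 1ℚ → suc r ℕ.+ suc m ≡ p →
    w p r ≡ ι (suc m !) * legendreSum (suc m) p
  legendreSum-w (suc N) m r odd eq = trans (w-U-sum N r m (ℕₚ.suc-injective eq))
    (cong (ι (suc m !) *_) (sym (∑-cong-< (suc N) {λ k → ∑-increasing m k
        (λ ks → summand p (ks ∷ʳ k))} {λ k → U (p ∸ k) * (recip k * harmonic k m)} (λ k k<p → term (suc k)
        (ℕₚ.<⇒≤ k<p)))))
    where
    open ≡-Reasoning
    p = suc N
    sign : ∀ k → k ℕ.≤ p → ιᶻ (legendre₃ (ℤ.+ p ℤ.- ℤ.+ k)) * (- 1ℚ) ^ k ≡ U (p ∸ k)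
    sign k k≤p = begin
      ιᶻ (legendre₃ (ℤ.+ p ℤ.- ℤ.+ k)) * f
        ≡⟨ cong (λ z → ιᶻ (legendre₃ z) * f) (trans (ℤₚ.m-n≡m⊖n p k) (ℤₚ.⊖-≥ k≤p)) ⟩
      ℓ (p ∸ k) * f
        ≡⟨ cong (ℓ (p ∸ k) *_) (trans (sym (ℚₚ.*-identityˡ f)) (cong (_* f) (sym (-1*-1^ (p ∸ k))))) ⟩
      ℓ (p ∸ k) * (e * e * f)
        ≡⟨ solve 3 (λ l e f → l :* (e :* e :* f) := l :* (e :* (e :* f))) refl (ℓ (p ∸ k)) e f ⟩
      ℓ (p ∸ k) * (e * (e * f))
        ≡⟨ cong (λ x → ℓ (p ∸ k) * (e * x)) (trans (sym (Expℚ.^-homo-* (- 1ℚ) (p ∸ k) k)) (trans (cong ((- 1ℚ) ^_)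
            (ℕₚ.m∸n+n≡m k≤p)) odd)) ⟩
      ℓ (p ∸ k) * (e * - 1ℚ)
        ≡⟨ solve 2 (λ l e → l :* (e :* con (- 1ℚ)) := :- (l :* e)) refl (ℓ (p ∸ k)) e ⟩
      U (p ∸ k) ∎
      where
      e f : ℚ
      e = (- 1ℚ) ^ (p ∸ k)
      f = (- 1ℚ) ^ k
    term : ∀ k → k ℕ.≤ p → ∑-increasing m k (λ ks → summand p (ks ∷ʳ k)) ≡ U (p ∸ k) * (recip k * harmonic k m)
    term k k≤p = begin
      ∑-increasing m k (λ ks → summand p (ks ∷ʳ k))
        ≡⟨ ∑-increasing-cong m k (λ ks → cong₂ (λ j x → ιᶻ (legendre₃ (ℤ.+ p ℤ.- ℤ.+ j)) * (- 1ℚ) ^ j * x)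
             (last-∷ʳ k ks) (trans (cong recip (product-∷ʳ ks k)) (recip-*′ k (product ks)))) ⟩
      ∑-increasing m k (λ ks → ιᶻ (legendre₃ (ℤ.+ p ℤ.- ℤ.+ k)) * (- 1ℚ) ^ k * (recip k * recip (product ks)))
        ≡⟨ ∑-increasing-cong m k (λ ks → trans (cong (_* (recip k * recip (product ks))) (sign k k≤p))
             (sym (ℚₚ.*-assoc (U (p ∸ k)) (recip k) (recip (product ks))))) ⟩
      ∑-increasing m k (λ ks → U (p ∸ k) * recip k * recip (product ks))
        ≡⟨ ∑-increasing-scale m k (U (p ∸ k) * recip k) (λ ks → recip (product ks)) ⟩
      U (p ∸ k) * recip k * harmonic k m
        ≡⟨ ℚₚ.*-assoc (U (p ∸ k)) (recip k) (harmonic k m) ⟩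
      U (p ∸ k) * (recip k * harmonic k m) ∎

  -- Reduced denominators and division by power series

  ιᶻ-injective : ∀ {a b} → ιᶻ a ≡ ιᶻ b → a ≡ b
  ιᶻ-injective {a} {b} eq with ℚₚ./-injective-≃ (ℚᵘ.mkℚᵘ a 0) (ℚᵘ.mkℚᵘ b 0) eq
  ... | ℚᵘ.*≡* a*1≡b*1 = trans (sym (ℤₚ.*-identityʳ a)) (trans a*1≡b*1 (ℤₚ.*-identityʳ b))

  -- Links the reduced denominator, which the congruence of the theorem tests, to the arbitrary
  -- denominators used as witnesses below: cross-multiplying, the reduced denominator divides n d
  -- and is coprime to n.
  ↧-minimal : ∀ x d a → x * ι d ≡ ιᶻ a → ↧ₙ x ∣ d
  ↧-minimal x@(mkℚ n d-1 c) d a eq =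
    Coprimality.coprime-divisor (Coprimality.sym (recompute (Coprimality.coprime? ℤ.∣ n ∣ (suc d-1)) c))
      (divides ℤ.∣ a ∣ (begin
        ℤ.∣ n ∣ ℕ.* d             ≡⟨ ℤₚ.abs-* n (+ d) ⟨
        ℤ.∣ n ℤ.* + d ∣           ≡⟨ cong ℤ.∣_∣ cross ⟩
        ℤ.∣ a ℤ.* + suc d-1 ∣     ≡⟨ ℤₚ.abs-* a (+ suc d-1) ⟩
        ℤ.∣ a ∣ ℕ.* suc d-1       ∎))
    where
    open ≡-Reasoning
    cross : n ℤ.* + d ≡ a ℤ.* + suc d-1
    cross = ιᶻ-injective (begin
      ιᶻ (n ℤ.* + d)                ≡⟨ ιᶻ-* n (+ d) ⟩
      ιᶻ n * ι d                    ≡⟨ cong (_* ι d) (/-cancel n (suc d-1)) ⟨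
      (n / suc d-1) * ι (suc d-1) * ι d ≡⟨ cong (λ y → y * ι (suc d-1) * ι d) (ℚₚ.↥p/↧p≡p x) ⟩
      x * ι (suc d-1) * ι d         ≡⟨ solve 3 (λ a b c → a :* b :* c := a :* c :* b) refl x (ι (suc d-1)) (ι d) ⟩
      x * ι d * ι (suc d-1)         ≡⟨ cong (_* ι (suc d-1)) eq ⟩
      ιᶻ a * ι (suc d-1)            ≡⟨ ιᶻ-* a (+ suc d-1) ⟨
      ιᶻ (a ℤ.* + suc d-1)          ∎)

  -- Since `u 0` is 1, `f r` is `(u ⊛ f) r` minus products with earlier coefficients of f, so strong
  -- induction applies. With O and P abstract, this serves division modulo powers of p and, when P
  -- is equality to 0, cancellation.
  ⊛-divide : (O P : ℚ → Set) → (∀ {x y} → P x → P y → P (x + y)) → (∀ {x} → P x → P (- x)) →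
    P 0ℚ → (∀ {x y} → O x → P y → P (x * y)) →
    ∀ N u f → u 0 ≡ 1ℚ → (∀ r → r ℕ.≤ N → O (u r)) → (∀ r → r ℕ.≤ N → P ((u ⊛ f) r)) →
    ∀ r → r ℕ.≤ N → P (f r)
  ⊛-divide O P P-+ P-neg P-0 P-* N u f u₀ u∈ uf∈ r r≤N = below r r≤N r ℕₚ.≤-refl
    where
    constant : ∀ r → u 0 * f r ≡ f r
    constant r = trans (cong (_* f r) u₀) (ℚₚ.*-identityˡ (f r))
    below : ∀ r → r ℕ.≤ N → ∀ j → j ℕ.≤ r → P (f j)
    below zero    r≤N .0 z≤n = subst P (trans (ℚₚ.+-identityʳ (u 0 * f 0)) (constant 0)) (uf∈ 0 z≤n)
    below (suc r) r<N j  j≤ with ℕₚ.m≤n⇒m<n∨m≡n j≤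
    ... | inj₁ j<  = below r (ℕₚ.<⇒≤ r<N) j (ℕₚ.≤-pred j<)
    ... | inj₂ refl = subst P
      (trans (solve 2 (λ a b → a :+ b :+ (:- b) := a) refl (u 0 * f (suc r)) (((u ∘ suc) ⊛ f) r)) (constant (suc r)))
      (P-+ (uf∈ (suc r) r<N) (P-neg (⊛-rel (λ x _ → P x) P-+ P-0 (u ∘ suc) (u ∘ suc) f f r
        (λ i j eq → P-* (u∈ (suc i) (ℕₚ.≤-trans (s≤s (ℕₚ.≤-trans (ℕₚ.m≤m+n i j) (ℕₚ.≤-reflexive eq))) r<N))
                        (below r (ℕₚ.<⇒≤ r<N) j (ℕₚ.≤-trans (ℕₚ.m≤n+m j i) (ℕₚ.≤-reflexive eq)))))))

  -- Cancels a divisor without constant term, such as e^(6t) - 1: one factor t is shifted away, and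
  -- a normalises what remains to constant coefficient 1.
  ⊛-cancel : ∀ g f a → a * g 0 ≡ 1ℚ → t· g ⊛ f ≗ 𝟎 → f ≗ 𝟎
  ⊛-cancel g f a ag₀ tgf r = ⊛-divide (λ _ → ⊤) (_≡ 0ℚ) (λ { refl refl → refl }) (λ { refl → refl }) refl
    (λ { {x} _ refl → ℚₚ.*-zeroʳ x }) r (λ k → a * g k) f ag₀ _
    (λ k _ → trans (⊛-scale a g f k) (trans (cong (a *_) (gf k)) (ℚₚ.*-zeroʳ a))) r ℕₚ.≤-refl
    where
    gf : ∀ k → (g ⊛ f) k ≡ 0ℚ
    gf k = begin
      (g ⊛ f) k              ≡⟨ ⊛-comm g f k ⟩
      (f ⊛ g) k              ≡⟨ ⊛-t· f g (suc k) ⟨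
      (f ⊛ t· g) (suc k)     ≡⟨ ⊛-comm f (t· g) (suc k) ⟩
      (t· g ⊛ f) (suc k)     ≡⟨ tgf (suc k) ⟩
      0ℚ                     ∎
      where open ≡-Reasoning

  ε : PowerSeries
  ε = t⁻¹· exp[t]-1

  rise-zero : ∀ s k → rise s k 0 ≡ ι (k !)
  rise-zero s zero    = refl
  rise-zero s (suc k) = begin
    (ι (suc k) - 0ℚ) * rise s k 0 + (s + ι k) * 0ℚ  ≡⟨ solve 3 (λ i v x → (i ⊝ con 0ℚ) :* v :+ x :* con 0ℚ := i :* v)
        refl (ι (suc k)) (rise s k 0) (s + ι k) ⟩
    ι (suc k) * rise s k 0                          ≡⟨ cong (ι (suc k) *_) (rise-zero s k) ⟩
    ι (suc k) * ι (k !)                             ≡⟨ ι-!-suc k ⟨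
    ι (suc k !)                                     ∎
    where open ≡-Reasoning

  -- The coefficient at t^k is the value of the polynomial at y = 0, hence the plain factor s + k.
  rise-top-suc : ∀ s k → rise s (suc k) (suc k) ≡ (s + ι k) * rise s k k
  rise-top-suc s k = solve 4 (λ i x v y → (i ⊝ i) :* x :+ y :* v := y :* v)
      refl (ι (suc k)) (rise s k (suc k)) (rise s k k) (s + ι k)

  rise-top-1 : ∀ k → rise 1ℚ k k ≡ ι (k !)
  rise-top-1 zero    = refl
  rise-top-1 (suc k) = begin
    rise 1ℚ (suc k) (suc k)   ≡⟨ rise-top-suc 1ℚ k ⟩
    (1ℚ + ι k) * rise 1ℚ k k  ≡⟨ cong₂ _*_ (sym (ι-suc k)) (rise-top-1 k) ⟩
    ι (suc k) * ι (k !)       ≡⟨ ι-!-suc k ⟨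
    ι (suc k !)               ∎
    where open ≡-Reasoning

  -- Computes (y + 1)(y + 2) ⋯ (y + k + 1) from (y + 2) ⋯ (y + k + 1) and from (y + 1) ⋯ (y + k).
  ε-rise : ∀ k r → r ℕ.≤ k →
    (ε ⊛ op (ι (suc k)) 0ℚ (rise 1ℚ k)) r ≡ ι (suc k) * rise 1ℚ k r
  ε-rise k r r≤k = begin
    (ε ⊛ V) r
      -- `(E 1ℚ ⊛ V) (suc r)` unfolds to 1 times `V (suc r)` plus `(ε ⊛ V) r`.
      ≡⟨ solve 2 (λ a b → b := con 1ℚ :* a :+ b ⊝ a) refl (V (suc r)) ((ε ⊛ V) r) ⟩
    (E 1ℚ ⊛ V) (suc r) - V (suc r)
      ≡⟨ cong (_- V (suc r)) two-ways ⟩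
    op (ι (suc k)) (ι (suc k)) Q (suc r) - V (suc r)
      ≡⟨ solve 3 (λ x i y → x :+ i :* y ⊝ (x :+ con 0ℚ :* y) := i :* y)
          refl ((ι (suc k) - ι (suc r)) * Q (suc r)) (ι (suc k)) (Q r) ⟩
    ι (suc k) * Q r ∎
    where
    open ≡-Reasoning
    Q V : PowerSeries
    Q = rise 1ℚ k
    V = op (ι (suc k)) 0ℚ Q
    two-ways : (E 1ℚ ⊛ V) (suc r) ≡ op (ι (suc k)) (ι (suc k)) Q (suc r)
    two-ways = begin
      (E 1ℚ ⊛ V) (suc r)                            ≡⟨ E-op 1ℚ (ι (suc k)) 0ℚ Q (suc r) ⟩
      op (ι (suc k)) 1ℚ (E 1ℚ ⊛ Q) (suc r)          ≡⟨ op-cong-≤ k 1ℚ (E-rise 1ℚ 1ℚ k) (suc r) (s≤s r≤k) ⟩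
      op (ι (suc k)) 1ℚ (rise (1ℚ + 1ℚ) k) (suc r)  ≡⟨ rise-left 1ℚ k (suc r) ⟨
      rise 1ℚ (suc k) (suc r)                       ≡⟨ cong (λ x → op (ι (suc k)) x Q (suc r)) (ι-suc k) ⟨
      op (ι (suc k)) (ι (suc k)) Q (suc r)          ∎

  -- Reflection and the Bernoulli numbers

  X-even : σ (- 1ℚ) X ≗ X
  X-even r = begin
    σ (- 1ℚ) X r
      ≡⟨ solve 4 (λ s a b c → s :* (a :+ b :+ :- c) := s :* b :+ s :* a :+ :- (s :* c))
          refl ((- 1ℚ) ^ r) (E 1ℚ r) (E (- 1ℚ) r) (𝟏 r) ⟩
    σ (- 1ℚ) (E (- 1ℚ)) r + σ (- 1ℚ) (E 1ℚ) r - σ (- 1ℚ) 𝟏 r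
      ≡⟨ cong₂ (λ a b → a + b - σ (- 1ℚ) 𝟏 r) (σ-E (- 1ℚ) (- 1ℚ) r) (σ-E (- 1ℚ) 1ℚ r) ⟩
    E 1ℚ r + E (- 1ℚ) r - σ (- 1ℚ) 𝟏 r
      ≡⟨ cong (λ x → E 1ℚ r + E (- 1ℚ) r - x) (σ-𝟏 r) ⟩
    X r ∎
    where
    open ≡-Reasoning
    σ-𝟏 : ∀ r → σ (- 1ℚ) 𝟏 r ≡ 𝟏 r
    σ-𝟏 zero    = refl
    σ-𝟏 (suc r) = ℚₚ.*-zeroʳ ((- 1ℚ) ^ suc r)

  -- W(- y - p) = W(y) for the polynomial W of degree p - 1 encoded by w p.
  X-w-reflect : ∀ k r → r ℕ.≤ k → (X ⊛ σ (- 1ℚ) (w (suc k))) r ≡ (X ⊛ (E (- ι (suc k)) ⊛ w (suc k))) r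
  X-w-reflect k r r≤k = begin
    (X ⊛ σ (- 1ℚ) W) r
      ≡⟨ ⊛-cong X-even (≗-refl {σ (- 1ℚ) W}) r ⟨
    (σ (- 1ℚ) X ⊛ σ (- 1ℚ) W) r
      ≡⟨ σ-⊛ (- 1ℚ) X W r ⟨
    (- 1ℚ) ^ r * (X ⊛ W) r
      ≡⟨ cong ((- 1ℚ) ^ r *_) (X-w (suc k) r (s≤s r≤k)) ⟩
    (- 1ℚ) ^ r * (recip (k !) * rise 1ℚ k r)
      ≡⟨ solve 3 (λ a b c → a :* (b :* c) := b :* (a :* c)) refl ((- 1ℚ) ^ r) (recip (k !)) (rise 1ℚ k r) ⟩
    recip (k !) * σ (- 1ℚ) (rise 1ℚ k) r
      ≡⟨ cong (recip (k !) *_) (rise-reflect k r) ⟩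
    recip (k !) * rise (- ι k) k r
      ≡⟨ cong (λ x → recip (k !) * rise x k r) (trans (solve 1 (λ i → :- i := con 1ℚ :+ :- (con 1ℚ :+ i))
          refl (ι k)) (cong (λ x → 1ℚ + - x) (sym (ι-suc k)))) ⟩
    recip (k !) * rise (1ℚ + - ι (suc k)) k r
      ≡⟨ cong (recip (k !) *_) (E-rise (- ι (suc k)) 1ℚ k r r≤k) ⟨
    recip (k !) * (E (- ι (suc k)) ⊛ rise 1ℚ k) r
      ≡⟨ cong (recip (k !) *_) (⊛-comm (E (- ι (suc k))) (rise 1ℚ k) r) ⟩
    recip (k !) * (rise 1ℚ k ⊛ E (- ι (suc k))) r
      ≡⟨ ⊛-scale (recip (k !)) (rise 1ℚ k) (E (- ι (suc k))) r ⟨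
    (binom 1ℚ k ⊛ E (- ι (suc k))) r
      ≡⟨ ⊛-rel _≡_ (cong₂ _+_) refl (binom 1ℚ k) (X ⊛ W) (E (- ι (suc k))) (E (- ι (suc k))) r
           (λ i j i+j → cong (_* E (- ι (suc k)) j) (sym (X-w (suc k) i (s≤s (ℕₚ.≤-trans (ℕₚ.m≤m+n i j) (ℕₚ.≤-trans
               (ℕₚ.≤-reflexive i+j) r≤k)))))) ⟩
    (X ⊛ W ⊛ E (- ι (suc k))) r
      ≡⟨ solveₛ 3 (λ x w e → x ⊠ w ⊠ e ≐ x ⊠ (e ⊠ w)) (λ _ → refl) X W (E (- ι (suc k))) r ⟩
    (X ⊛ (E (- ι (suc k)) ⊛ W)) r ∎
    where
    open ≡-Reasoning
    W = w (suc k)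

  β : PowerSeries
  β = bernoulliSeries (+ 1 / 3)

  ε-β : ε ⊛ β ≗ E (+ 1 / 3)
  ε-β r = trans (⊛-comm ε β r) (quotient-⊛ (t⁻¹· (t· exp[ + 1 / 3 t])) (t⁻¹· exp[t]-1) r)

  β-scaled : ∀ c → σ c β ⊛ (E c ⊕ ⊖ 𝟏) ≗ C c ⊛ T ⊛ E (c * (+ 1 / 3))
  β-scaled c r = begin
    (σ c β ⊛ (E c ⊕ ⊖ 𝟏)) r
      ≡⟨ ⊛-cong (≗-refl {σ c β}) exp-1 r ⟩
    (σ c β ⊛ σ c (t· ε)) r
      ≡⟨ σ-⊛ c β (t· ε) r ⟨
    σ c (β ⊛ t· ε) r
      ≡⟨ σ-cong c (λ r → trans (⊛-t· β ε r) (t·-cong (λ r → trans (⊛-comm β ε r) (ε-β r)) r)) r ⟩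
    σ c (t· E (+ 1 / 3)) r
      ≡⟨ σ-t· c (E (+ 1 / 3)) r ⟩
    c * (t· σ c (E (+ 1 / 3))) r
      ≡⟨ cong (c *_) (t·-cong (σ-E c (+ 1 / 3)) r) ⟩
    c * (t· E (c * (+ 1 / 3))) r
      ≡⟨ CT-⊛ c (E (c * (+ 1 / 3))) r ⟨
    (C c ⊛ T ⊛ E (c * (+ 1 / 3))) r ∎
    where
    open ≡-Reasoning
    exp-1 : E c ⊕ ⊖ 𝟏 ≗ σ c (t· ε)
    exp-1 zero    = refl
    exp-1 (suc r) = trans (ℚₚ.+-identityʳ (E c (suc r)))
      (trans (cong (λ x → E x (suc r)) (sym (ℚₚ.*-identityʳ c))) (sym (σ-E c 1ℚ (suc r))))

  -- Expanding the fraction β(- ct) by - e^(ct) moves the argument from 1/3 to 2/3, as in the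
  -- reflection formula B_m(1 - x) = (-1)^m B_m(x).
  β-scaled-neg : ∀ c → σ (- c) β ⊛ (E c ⊕ ⊖ 𝟏) ≗ C c ⊛ T ⊛ E (c * (+ 2 / 3))
  β-scaled-neg c = begin
    σ (- c) β ⊛ (E c ⊕ ⊖ 𝟏)
      ≈⟨ ⊛-cong (≗-refl {σ (- c) β}) factor ⟩
    σ (- c) β ⊛ (⊖ E c ⊛ (E (- c) ⊕ ⊖ 𝟏))
      ≈⟨ solveₛ 3 (λ s e f → s ⊠ (⊟ e ⊠ f) ≐ ⊟ (e ⊠ (s ⊠ f))) (λ _ → refl) (σ (- c) β) (E c) (E (- c) ⊕ ⊖ 𝟏) ⟩
    ⊖ (E c ⊛ (σ (- c) β ⊛ (E (- c) ⊕ ⊖ 𝟏)))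
      ≈⟨ ⊖-cong (⊛-cong (≗-refl {E c}) (β-scaled (- c))) ⟩
    ⊖ (E c ⊛ (C (- c) ⊛ T ⊛ E (- c * (+ 1 / 3))))
      ≈⟨ ⊖-cong (⊛-cong (≗-refl {E c}) (⊛-cong (⊛-cong C-neg (≗-refl {T})) (≗-refl {E (- c * (+ 1 / 3))}))) ⟩
    ⊖ (E c ⊛ (⊖ C c ⊛ T ⊛ E (- c * (+ 1 / 3))))
      ≈⟨ solveₛ 4 (λ e c t f → ⊟ (e ⊠ (⊟ c ⊠ t ⊠ f))
          ≐ c ⊠ t ⊠ (e ⊠ f)) (λ _ → refl) (E c) (C c) T (E (- c * (+ 1 / 3))) ⟩
    C c ⊛ T ⊛ (E c ⊛ E (- c * (+ 1 / 3)))
      ≈⟨ ⊛-cong (≗-refl {C c ⊛ T}) (≗-trans (E-⊛ c (- c * (+ 1 / 3))) (λ r → cong (λ x → E x r)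
           (solve 1 (λ c → c :+ :- c :* con (+ 1 / 3) := c :* con (+ 2 / 3)) refl c))) ⟩
    C c ⊛ T ⊛ E (c * (+ 2 / 3)) ∎
    where
    open import Relation.Binary.Reasoning.Setoid series-setoid
    C-neg : C (- c) ≗ ⊖ C c
    C-neg zero    = refl
    C-neg (suc r) = refl
    factor : E c ⊕ ⊖ 𝟏 ≗ ⊖ E c ⊛ (E (- c) ⊕ ⊖ 𝟏)
    factor = begin
      E c ⊕ ⊖ 𝟏                     ≈⟨ ⊕-cong (≗-refl {E c}) (⊖-cong (≗-sym (≗-trans (E-⊛ c (- c)) (≗-trans
          (λ r → cong (λ x → E x r) (ℚₚ.+-inverseʳ c)) E-0)))) ⟩
      E c ⊕ ⊖ (E c ⊛ E (- c))       ≈⟨ solveₛ 2 (λ e f → e ⊞ ⊟ (e ⊠ f)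
          ≐ ⊟ e ⊠ (f ⊞ ⊟ κ 1ℚ)) (λ _ → refl) (E c) (E (- c)) ⟩
      ⊖ E c ⊛ (E (- c) ⊕ ⊖ 𝟏)       ∎

  -- Twice the odd part of β(ct). With u = e^(ct/3) it equals c t (u - u²) / (u³ - 1) = - c t u /
  -- (u² + u + 1).
  β-odd : ℚ → PowerSeries
  β-odd c = σ c β ⊕ ⊖ σ (- c) β

  β-odd-⊛ : ∀ c → β-odd c ⊛ (E c ⊕ ⊖ 𝟏) ≗ C c ⊛ T ⊛ (E (c * (+ 1 / 3)) ⊕ ⊖ E (c * (+ 2 / 3)))
  β-odd-⊛ c = begin
    β-odd c ⊛ (E c ⊕ ⊖ 𝟏)
      ≈⟨ solveₛ 3 (λ a b e → (a ⊞ ⊟ b) ⊠ e ≐ a ⊠ e ⊞ ⊟ (b ⊠ e)) (λ _ → refl) (σ c β) (σ (- c) β) (E c ⊕ ⊖ 𝟏) ⟩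
    σ c β ⊛ (E c ⊕ ⊖ 𝟏) ⊕ ⊖ (σ (- c) β ⊛ (E c ⊕ ⊖ 𝟏))
      ≈⟨ ⊕-cong (β-scaled c) (⊖-cong (β-scaled-neg c)) ⟩
    C c ⊛ T ⊛ E (c * (+ 1 / 3)) ⊕ ⊖ (C c ⊛ T ⊛ E (c * (+ 2 / 3)))
      ≈⟨ solveₛ 3 (λ t e f → t ⊠ e ⊞ ⊟ (t ⊠ f)
          ≐ t ⊠ (e ⊞ ⊟ f)) (λ _ → refl) (C c ⊛ T) (E (c * (+ 1 / 3))) (E (c * (+ 2 / 3))) ⟩
    C c ⊛ T ⊛ (E (c * (+ 1 / 3)) ⊕ ⊖ E (c * (+ 2 / 3))) ∎
    where open import Relation.Binary.Reasoning.Setoid series-setoid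

  -- For c = 3 and c = 6 the u of `β-odd` is e^t and e^(2t), and the factors c have the ratio 1 : 2
  -- of the partial fractions. The common factor - 3 t is what `X-Y` retains.
  Y : PowerSeries
  Y = β-odd (ι 3) ⊕ β-odd (ι 6)

  -- With x = e^t, both odd parts have the denominator x⁶ - 1 = (x² - x + 1)(x + 1)(x³ - 1), and
  -- x X = x² - x + 1.
  X-Y : X ⊛ Y ≗ C (- ι 3) ⊛ T
  X-Y r = begin
    (X ⊛ Y) r
      ≡⟨ solve 2 (λ a c → a := a :+ :- c :+ c) refl ((X ⊛ Y) r) ((C (- ι 3) ⊛ T) r) ⟩
    Δ r + (C (- ι 3) ⊛ T) r
      ≡⟨ cong (_+ (C (- ι 3) ⊛ T) r) (Δ≡0 r) ⟩
    0ℚ + (C (- ι 3) ⊛ T) r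
      ≡⟨ ℚₚ.+-identityˡ ((C (- ι 3) ⊛ T) r) ⟩
    (C (- ι 3) ⊛ T) r ∎
    where
    open ≡-Reasoning
    x x̄ x³ x⁶ D₃ D₆ Δ : PowerSeries
    x = E 1ℚ
    x̄ = E (- 1ℚ)
    x³ = x ⊛ x ⊛ x
    x⁶ = x³ ⊛ x³
    D₃ = β-odd (ι 3)
    D₆ = β-odd (ι 6)
    Δ = X ⊛ Y ⊕ ⊖ (C (- ι 3) ⊛ T)
    x-x̄ : x ⊛ x̄ ≗ 𝟏
    x-x̄ = ≗-trans (E-⊛ 1ℚ (- 1ℚ)) E-0
    E₂ : E (ι 2) ≗ x ⊛ x
    E₂ = ≗-sym (E-⊛ 1ℚ 1ℚ)
    E₃ : E (ι 3) ≗ x³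
    E₃ = ≗-sym (≗-trans (⊛-cong (E-⊛ 1ℚ 1ℚ) (≗-refl {x})) (E-⊛ (ι 2) 1ℚ))
    E₄ : E (ι 4) ≗ x ⊛ x ⊛ (x ⊛ x)
    E₄ = ≗-sym (≗-trans (⊛-cong (E-⊛ 1ℚ 1ℚ) (E-⊛ 1ℚ 1ℚ)) (E-⊛ (ι 2) (ι 2)))
    E₆ : E (ι 6) ≗ x⁶
    E₆ = ≗-sym (≗-trans (⊛-cong (≗-sym E₃) (≗-sym E₃)) (E-⊛ (ι 3) (ι 3)))
    D₃-eq : D₃ ⊛ (x³ ⊕ ⊖ 𝟏) ≗ C (ι 3) ⊛ T ⊛ (x ⊕ ⊖ (x ⊛ x))
    D₃-eq = ≗-trans (⊛-cong (≗-refl {D₃}) (⊕-cong (≗-sym E₃) (≗-refl {⊖ 𝟏}))) (≗-trans (β-odd-⊛ (ι 3))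
      (⊛-cong (≗-refl {C (ι 3) ⊛ T}) (⊕-cong (≗-refl {x}) (⊖-cong E₂))))
    D₆-eq : D₆ ⊛ (x⁶ ⊕ ⊖ 𝟏) ≗ C (ι 6) ⊛ T ⊛ (x ⊛ x ⊕ ⊖ (x ⊛ x ⊛ (x ⊛ x)))
    D₆-eq = ≗-trans (⊛-cong (≗-refl {D₆}) (⊕-cong (≗-sym E₆) (≗-refl {⊖ 𝟏}))) (≗-trans (β-odd-⊛ (ι 6))
      (⊛-cong (≗-refl {C (ι 6) ⊛ T}) (⊕-cong E₂ (⊖-cong E₄))))
    x⁶-1-Δ : x ⊛ ((x⁶ ⊕ ⊖ 𝟏) ⊛ Δ) ≗ 𝟎
    x⁶-1-Δ n = begin
      (x ⊛ ((x⁶ ⊕ ⊖ 𝟏) ⊛ Δ)) n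
        -- The solver treats x and x̄ as independent, so the product of x and x̄ is kept for the
        -- next step to replace by 1. The factor x in front is there to create it.
        ≡⟨ solveₛ 5 (λ x x̄ t d₃ d₆ → let x³ = x ⊠ x ⊠ x ; x⁶ = x³ ⊠ x³ in
             x ⊠ ((x⁶ ⊞ ⊟ κ 1ℚ) ⊠ ((x ⊞ x̄ ⊞ ⊟ κ 1ℚ) ⊠ (d₃ ⊞ d₆) ⊞ ⊟ (κ (- ι 3) ⊠ t)))
             ≐ (x ⊠ x ⊞ x ⊠ x̄ ⊞ ⊟ x) ⊠ ((x³ ⊞ κ 1ℚ) ⊠ (d₃ ⊠ (x³ ⊞ ⊟ κ 1ℚ)) ⊞ d₆ ⊠ (x⁶ ⊞ ⊟ κ 1ℚ))
               ⊞ x ⊠ (x⁶ ⊞ ⊟ κ 1ℚ) ⊠ (κ (ι 3) ⊠ t)) (λ _ → refl) x x̄ T D₃ D₆ n ⟩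
      ((x ⊛ x ⊕ x ⊛ x̄ ⊕ ⊖ x) ⊛ ((x³ ⊕ 𝟏) ⊛ (D₃ ⊛ (x³ ⊕ ⊖ 𝟏)) ⊕ D₆ ⊛ (x⁶ ⊕ ⊖ 𝟏)) ⊕ x ⊛ (x⁶ ⊕ ⊖ 𝟏) ⊛ (C (ι 3) ⊛ T)) n
        ≡⟨ ⊕-cong (⊛-cong (⊕-cong (⊕-cong (≗-refl {x ⊛ x}) x-x̄) (≗-refl {⊖ x})) (⊕-cong (⊛-cong (≗-refl {x³ ⊕ 𝟏}) D₃-eq) D₆-eq))
                  (≗-refl {x ⊛ (x⁶ ⊕ ⊖ 𝟏) ⊛ (C (ι 3) ⊛ T)}) n ⟩
      ((x ⊛ x ⊕ 𝟏 ⊕ ⊖ x) ⊛ ((x³ ⊕ 𝟏) ⊛ (C (ι 3) ⊛ T ⊛ (x ⊕ ⊖ (x ⊛ x))) ⊕ C (ι 6) ⊛ T ⊛ (x ⊛ x ⊕ ⊖ (x ⊛ x ⊛ (x ⊛ x)))) ⊕ x ⊛ (x⁶ ⊕ ⊖ 𝟏) ⊛ (C (ι 3) ⊛ T)) n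
        ≡⟨ solveₛ 2 (λ x t → let x³ = x ⊠ x ⊠ x ; x⁶ = x³ ⊠ x³ in
             (x ⊠ x ⊞ κ 1ℚ ⊞ ⊟ x) ⊠ ((x³ ⊞ κ 1ℚ) ⊠ (κ (ι 3) ⊠ t ⊠ (x ⊞ ⊟ (x ⊠ x))) ⊞ κ (ι 6) ⊠ t ⊠ (x ⊠ x ⊞ ⊟ (x ⊠ x ⊠ (x ⊠ x))))
               ⊞ x ⊠ (x⁶ ⊞ ⊟ κ 1ℚ) ⊠ (κ (ι 3) ⊠ t) ≐ κ 0ℚ) (λ _ → refl) x T n ⟩
      C 0ℚ n
        ≡⟨ C-0 n ⟩
      0ℚ ∎
      where
      C-0 : ∀ n → C 0ℚ n ≡ 0ℚ
      C-0 zero    = refl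
      C-0 (suc n) = refl
    x⁶-1-Δ′ : (x⁶ ⊕ ⊖ 𝟏) ⊛ Δ ≗ 𝟎
    x⁶-1-Δ′ n = ⊛-divide (λ _ → ⊤) (_≡ 0ℚ) (λ { refl refl → refl }) (λ { refl → refl }) refl
      (λ { {x} _ refl → ℚₚ.*-zeroʳ x }) n x ((x⁶ ⊕ ⊖ 𝟏) ⊛ Δ) refl _ (λ k _ → x⁶-1-Δ k) n ℕₚ.≤-refl
    Δ≡0 : Δ ≗ 𝟎
    -- e^(6t) - 1 begins with 6 t, hence the normalising factor 1/6.
    Δ≡0 = ⊛-cancel (λ k → E (ι 6) (suc k)) Δ (+ 1 / 6) refl (λ n → trans (⊛-cong split (≗-refl {Δ}) n) (x⁶-1-Δ′ n))
      where
      split : t· (λ k → E (ι 6) (suc k)) ≗ x⁶ ⊕ ⊖ 𝟏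
      split = ≗-trans (λ { zero → refl ; (suc k) → sym (ℚₚ.+-identityʳ _) }) (⊕-cong E₆ (≗-refl {⊖ 𝟏}))

  ι-^ : ∀ m n → ι (m ℕ.^ n) ≡ ι m ^ n
  ι-^ m zero    = refl
  ι-^ m (suc n) = trans (ι-* m (m ℕ.^ n)) (cong (ι m *_) (ι-^ m n))

  neg-^ : ∀ c m → (- c) ^ m ≡ (- 1ℚ) ^ m * c ^ m
  neg-^ c m = trans (cong (_^ m) (solve 1 (λ c → :- c := con (- 1ℚ) :* c) refl c)) (Expℚ.^-distrib-* (- 1ℚ) c m)

  -1^-even : ∀ {n} → 2 ∣ n → (- 1ℚ) ^ n ≡ 1ℚ
  -1^-even (divides zero    refl) = refl
  -1^-even (divides (suc k) refl) = trans (solve 1 (λ e → con (- 1ℚ) :* (con (- 1ℚ) :* e) := e)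
      refl ((- 1ℚ) ^ (k ℕ.* 2)))
                                          (-1^-even (divides k refl))

  -1^-odd : ∀ {n} → 2 ∤ n → (- 1ℚ) ^ n ≡ - 1ℚ
  -1^-odd {zero}        2∤0   = contradiction (2 ∣0) 2∤0
  -1^-odd {suc zero}    _     = refl
  -1^-odd {suc (suc n)} 2∤2+n = trans (solve 1 (λ e → con (- 1ℚ) :* (con (- 1ℚ) :* e) := e) refl ((- 1ℚ) ^ n))
                                      (-1^-odd (2∤2+n ∘ ∣m∣n⇒∣m+n ∣-refl))

  Y-odd : ∀ m → (- 1ℚ) ^ m ≡ - 1ℚ → Y m ≡ ι 2 * (ι 3 ^ m + ι 6 ^ m) * β m
  Y-odd m odd = begin
    ι 3 ^ m * β m - (- ι 3) ^ m * β m + (ι 6 ^ m * β m - (- ι 6) ^ m * β m)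
      ≡⟨ cong₂ (λ x y → ι 3 ^ m * β m - x * β m + (ι 6 ^ m * β m - y * β m))
           (trans (neg-^ (ι 3) m) (cong (_* ι 3 ^ m) odd)) (trans (neg-^ (ι 6) m) (cong (_* ι 6 ^ m) odd)) ⟩
    ι 3 ^ m * β m - (- 1ℚ * ι 3 ^ m) * β m + (ι 6 ^ m * β m - (- 1ℚ * ι 6 ^ m) * β m)
      ≡⟨ solve 3 (λ x y b → x :* b ⊝ con (- 1ℚ) :* x :* b :+ (y :* b ⊝ con (- 1ℚ) :* y :* b)
          := con (ι 2) :* (x :+ y) :* b) refl (ι 3 ^ m) (ι 6 ^ m) (β m) ⟩
    ι 2 * (ι 3 ^ m + ι 6 ^ m) * β m ∎
    where open ≡-Reasoning

  -- `X-Y` divided by t, possible because the constant terms cancel in each odd part. So the tail of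
  -- `Y` is - 3 / X.
  X-Y-tail : ∀ r → (X ⊛ (Y ∘ suc)) r ≡ - ι 3 * 𝟏 r
  X-Y-tail r = begin
    (X ⊛ (Y ∘ suc)) r          ≡⟨ ⊛-t· X (Y ∘ suc) (suc r) ⟨
    (X ⊛ t· (Y ∘ suc)) (suc r) ≡⟨ ⊛-cong (≗-refl {X}) split (suc r) ⟩
    (X ⊛ Y) (suc r)            ≡⟨ X-Y (suc r) ⟩
    (C (- ι 3) ⊛ T) (suc r)    ≡⟨ C-⊛ (- ι 3) T (suc r) ⟩
    - ι 3 * 𝟏 r                ∎
    where
    open ≡-Reasoning
    split : t· (Y ∘ suc) ≗ Y
    split zero    = solve 1 (λ b → con 0ℚ := con 1ℚ :* b ⊝ con 1ℚ :* b :+ (con 1ℚ :* b ⊝ con 1ℚ :* b)) refl (β 0)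
    split (suc r) = refl

  -- Congruences modulo p = q + 3

  module Adic {q : ℕ} (p-prime : Prime (3 ℕ.+ q)) (3<p : 3 ℕ.< 3 ℕ.+ q) where

    -- Writing p as 3 + q keeps subtraction out of the two truncation points: 2 + q is p - 1, the
    -- range of the exponentials, and 1 + q is p - 2, the range of `ε`, whose coefficients involve
    -- the next factorial.
    p : ℕ
    p = 3 ℕ.+ q

    -- x ∈ p^s ℤ₍ₚ₎
    record 𝔪 (s : ℕ) (x : ℚ) : Set where
      constructor 𝔪-intro
      field
        denominator   : ℕ
        p∤denominator : p ∤ denominator
        numerator     : ℤ
        equation      : x * ι denominator ≡ ι (p ℕ.^ s) * ιᶻ numerator

    p∤1 : p ∤ 1
    p∤1 p∣1 with () ← ∣1⇒≡1 p∣1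

    p∤* : ∀ {m n} → p ∤ m → p ∤ n → p ∤ m ℕ.* n
    p∤* {m} {n} p∤m p∤n p∣mn = [ p∤m , p∤n ] (euclidsLemma m n p-prime p∣mn)

    p∤< : ∀ {n} .{{_ : ℕ.NonZero n}} → n ℕ.< p → p ∤ n
    p∤< n<p = >⇒∤ n<p

    p∤! : ∀ {n} → n ℕ.< p → p ∤ n !
    p∤! {zero}  _   = p∤1
    p∤! {suc n} n<p = p∤* {suc n} {n !} (p∤< n<p) (p∤! (ℕₚ.<⇒≤ n<p))

    𝔪-+ : ∀ {s x y} → 𝔪 s x → 𝔪 s y → 𝔪 s (x + y)
    𝔪-+ {s} {x} {y} (𝔪-intro d p∤d a xd≡a) (𝔪-intro e p∤e b ye≡b) =
      𝔪-intro (d ℕ.* e) (p∤* {d} {e} p∤d p∤e) (a ℤ.* + e ℤ.+ b ℤ.* + d) (begin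
        (x + y) * ι (d ℕ.* e)                      ≡⟨ cong ((x + y) *_) (ι-* d e) ⟩
        (x + y) * (ι d * ι e)                      ≡⟨ solve 4 (λ x y d e → (x :+ y) :* (d :* e)
            := x :* d :* e :+ y :* e :* d) refl x y (ι d) (ι e) ⟩
        x * ι d * ι e + y * ι e * ι d              ≡⟨ cong₂ (λ u v → u * ι e + v * ι d) xd≡a ye≡b ⟩
        P * ιᶻ a * ι e + P * ιᶻ b * ι d            ≡⟨ solve 5 (λ p a e b d → p :* a :* e :+ p :* b :* d
            := p :* (a :* e :+ b :* d)) refl P (ιᶻ a) (ι e) (ιᶻ b) (ι d) ⟩
        P * (ιᶻ a * ι e + ιᶻ b * ι d)              ≡⟨ cong (P *_)
            (trans (ιᶻ-+ (a ℤ.* + e) (b ℤ.* + d)) (cong₂ _+_ (ιᶻ-* a (+ e)) (ιᶻ-* b (+ d)))) ⟨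
        P * ιᶻ (a ℤ.* + e ℤ.+ b ℤ.* + d)           ∎)
      where
      open ≡-Reasoning
      P : ℚ
      P = ι (p ℕ.^ s)

    𝔪-* : ∀ {s t x y} → 𝔪 s x → 𝔪 t y → 𝔪 (s ℕ.+ t) (x * y)
    𝔪-* {s} {t} {x} {y} (𝔪-intro d p∤d a xd≡a) (𝔪-intro e p∤e b ye≡b) =
      𝔪-intro (d ℕ.* e) (p∤* {d} {e} p∤d p∤e) (a ℤ.* b) (begin
        x * y * ι (d ℕ.* e)                        ≡⟨ cong (x * y *_) (ι-* d e) ⟩
        x * y * (ι d * ι e)                        ≡⟨ solve 4 (λ x y d e → x :* y :* (d :* e)
            := x :* d :* (y :* e)) refl x y (ι d) (ι e) ⟩
        x * ι d * (y * ι e)                        ≡⟨ cong₂ _*_ xd≡a ye≡b ⟩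
        ι (p ℕ.^ s) * ιᶻ a * (ι (p ℕ.^ t) * ιᶻ b)  ≡⟨ solve 4 (λ x y d e → x :* y :* (d :* e) := x :* d :* (y :* e))
            refl (ι (p ℕ.^ s)) (ιᶻ a) (ι (p ℕ.^ t)) (ιᶻ b) ⟩
        ι (p ℕ.^ s) * ι (p ℕ.^ t) * (ιᶻ a * ιᶻ b)  ≡⟨ cong₂ _*_ (trans (cong ι
            (ℕₚ.^-distribˡ-+-* p s t)) (ι-* (p ℕ.^ s) (p ℕ.^ t))) (ιᶻ-* a b) ⟨
        ι (p ℕ.^ (s ℕ.+ t)) * ιᶻ (a ℤ.* b)         ∎)
      where open ≡-Reasoning

    integral-ιᶻ : ∀ a → 𝔪 0 (ιᶻ a)
    integral-ιᶻ a = 𝔪-intro 1 p∤1 a (ℚₚ.*-comm (ιᶻ a) 1ℚ)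

    integral-ι : ∀ n → 𝔪 0 (ι n)
    integral-ι n = integral-ιᶻ (+ n)

    integral-recip : ∀ {n} → p ∤ n → 𝔪 0 (recip n)
    integral-recip {zero}  p∤0 = integral-ι 0
    integral-recip {suc n} p∤n = 𝔪-intro (suc n) p∤n (+ 1) (recip-cancel (suc n))

    𝔪-ι : ∀ s → 𝔪 s (ι (p ℕ.^ s))
    𝔪-ι s = 𝔪-intro 1 p∤1 (+ 1) refl

    𝔪-p : 𝔪 1 (ι p)
    𝔪-p = subst (λ n → 𝔪 1 (ι n)) (ℕₚ.*-identityʳ p) (𝔪-ι 1)

    𝔪-0 : ∀ {s} → 𝔪 s 0ℚ
    𝔪-0 {s} = 𝔪-intro 1 p∤1 (+ 0) (sym (ℚₚ.*-zeroʳ (ι (p ℕ.^ s))))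

    𝔪-neg : ∀ {s x} → 𝔪 s x → 𝔪 s (- x)
    𝔪-neg {s} {x} x∈ = subst (𝔪 s) (solve 1 (λ x → con (- 1ℚ) :* x := :- x) refl x) (𝔪-* (integral-ιᶻ (ℤ.- (+ 1))) x∈)

    𝔪-^ : ∀ {x} → 𝔪 0 x → ∀ n → 𝔪 0 (x ^ n)
    𝔪-^ x∈ zero    = integral-ι 1
    𝔪-^ x∈ (suc n) = 𝔪-* x∈ (𝔪-^ x∈ n)

    𝔪⇒∤↧ : ∀ {x} → 𝔪 0 x → p ∤ ↧ₙ x
    𝔪⇒∤↧ {x} (𝔪-intro d p∤d a eq) p∣↧ =
      p∤d (∣-trans p∣↧ (↧-minimal x d a (trans eq (ℚₚ.*-identityˡ (ιᶻ a)))))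

    infix 4 _≈[_]_
    record _≈[_]_ (x : ℚ) (s : ℕ) (y : ℚ) : Set where
      constructor ≈-intro
      field difference : 𝔪 s (x - y)
    open _≈[_]_ public

    ≈-reflexive : ∀ {s x y} → x ≡ y → x ≈[ s ] y
    ≈-reflexive {s} {x} refl = ≈-intro (subst (𝔪 s) (sym (ℚₚ.+-inverseʳ x)) 𝔪-0)

    ≈-sym : ∀ {s x y} → x ≈[ s ] y → y ≈[ s ] x
    ≈-sym {s} {x} {y} (≈-intro d) = ≈-intro (subst (𝔪 s) (solve 2 (λ x y → :- (x ⊝ y) := y ⊝ x) refl x y) (𝔪-neg d))

    ≈-trans : ∀ {s x y z} → x ≈[ s ] y → y ≈[ s ] z → x ≈[ s ] z
    ≈-trans {s} {x} {y} {z} (≈-intro d) (≈-intro e) =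
      ≈-intro (subst (𝔪 s) (solve 3 (λ x y z → x ⊝ y :+ (y ⊝ z) := x ⊝ z) refl x y z) (𝔪-+ d e))

    ≈-+ : ∀ {s a b c d} → a ≈[ s ] b → c ≈[ s ] d → a + c ≈[ s ] b + d
    ≈-+ {s} {a} {b} {c} {d} (≈-intro x) (≈-intro y) =
      ≈-intro (subst (𝔪 s) (solve 4 (λ a b c d → a ⊝ b :+ (c ⊝ d) := a :+ c ⊝ (b :+ d)) refl a b c d) (𝔪-+ x y))

    ≈-*ˡ : ∀ {s t a b c} → 𝔪 t c → a ≈[ s ] b → c * a ≈[ t ℕ.+ s ] c * b
    ≈-*ˡ {s} {t} {a} {b} {c} c∈ (≈-intro x) =
      ≈-intro (subst (𝔪 (t ℕ.+ s)) (solve 3 (λ a b c → c :* (a ⊝ b) := c :* a ⊝ c :* b) refl a b c) (𝔪-* c∈ x))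

    ≈-neg : ∀ {s a b} → a ≈[ s ] b → - a ≈[ s ] - b
    ≈-neg {s} {a} {b} (≈-intro x) =
      ≈-intro (subst (𝔪 s) (solve 2 (λ a b → :- (a ⊝ b) := (:- a) ⊝ (:- b)) refl a b) (𝔪-neg x))

    ≈-cancel : ∀ {s a b} k → p ∤ k → ι k * a ≈[ s ] ι k * b → a ≈[ s ] b
    ≈-cancel zero    p∤0 _  = contradiction (p ∣0) p∤0
    ≈-cancel {s} {a} {b} k@(suc _) p∤k eq = subst₂
        (λ x y → x ≈[ s ] y) (lemma a) (lemma b) (≈-*ˡ (integral-recip p∤k) eq)
      where
      lemma : ∀ z → recip k * (ι k * z) ≡ z
      lemma z = trans (sym (ℚₚ.*-assoc (recip k) (ι k) z)) (trans (cong (_* z) (recip-cancel k)) (ℚₚ.*-identityˡ z))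

    𝔪⇒≈ : ∀ {s x} → 𝔪 s x → x ≈[ s ] 0ℚ
    𝔪⇒≈ {s} {x} x∈ = ≈-intro (subst (𝔪 s) (solve 1 (λ x → x := x ⊝ con 0ℚ) refl x) x∈)

    ≈⇒𝔪 : ∀ {s x} → x ≈[ s ] 0ℚ → 𝔪 s x
    ≈⇒𝔪 {s} {x} (≈-intro d) = subst (𝔪 s) (solve 1 (λ x → x ⊝ con 0ℚ := x) refl x) d

    𝔪-⊛-divide : ∀ {s} N u f → u 0 ≡ 1ℚ → (∀ r → r ℕ.≤ N → 𝔪 0 (u r)) →
      (∀ r → r ℕ.≤ N → 𝔪 s ((u ⊛ f) r)) → ∀ r → r ℕ.≤ N → 𝔪 s (f r)
    𝔪-⊛-divide {s} = ⊛-divide (𝔪 0) (𝔪 s) 𝔪-+ 𝔪-neg 𝔪-0 𝔪-*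

    integral-exp : ∀ {a} → 𝔪 0 a → ∀ r → r ℕ.< p → 𝔪 0 (E a r)
    integral-exp a∈ r r<p = 𝔪-* (𝔪-^ a∈ r) (integral-recip (p∤! r<p))

    integral-rise : ∀ {s} → 𝔪 0 s → ∀ k r → 𝔪 0 (rise s k r)
    integral-rise s∈ zero    zero    = integral-ι 1
    integral-rise s∈ zero    (suc r) = 𝔪-0
    integral-rise {s} s∈ (suc k) r = 𝔪-+
      (𝔪-* (𝔪-+ (integral-ι (suc k)) (𝔪-neg (integral-ι r))) (integral-rise s∈ k r))
      (𝔪-* (𝔪-+ s∈ (integral-ι k)) (shifted r))
      where
      shifted : ∀ r → 𝔪 0 ((t· rise s k) r)
      shifted zero    = 𝔪-0
      shifted (suc r) = integral-rise s∈ k r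

    integral-ε : ∀ r → r ℕ.≤ 1 ℕ.+ q → 𝔪 0 (ε r)
    integral-ε r r≤ = integral-exp (integral-ι 1) (suc r) (s≤s (s≤s r≤))

    -- Lagrange's argument for Wilson's theorem. V encodes y (y + 1) ⋯ (y + p - 1), and `ε-rise`
    -- gives ε V = p Q, so dividing by ε makes V vanish modulo p up to t^(p-2). As `V r` is (p - r)
    -- times `Q r`, this leaves r times `Q r` divisible by p, with r prime to p.
    rise-coefficients : ∀ r → suc r ℕ.≤ 1 ℕ.+ q → 𝔪 1 (rise 1ℚ (2 ℕ.+ q) (suc r))
    rise-coefficients r r≤ = ≈⇒𝔪 (≈-cancel (suc r) (p∤< (ℕₚ.≤-trans (s≤s r≤) (ℕₚ.n≤1+n _)))
      (≈-trans (𝔪⇒≈ r*Q) (≈-reflexive (sym (ℚₚ.*-zeroʳ (ι (suc r)))))))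
      where
      Q V : PowerSeries
      Q = rise 1ℚ (2 ℕ.+ q)
      V = op (ι p) 0ℚ Q
      Q∈ : ∀ r → 𝔪 0 (Q r)
      Q∈ = integral-rise (integral-ι 1) (2 ℕ.+ q)
      V∈ : ∀ r → r ℕ.≤ 1 ℕ.+ q → 𝔪 1 (V r)
      V∈ = 𝔪-⊛-divide (1 ℕ.+ q) ε V refl integral-ε
        (λ r r≤ → subst (𝔪 1) (sym (ε-rise (2 ℕ.+ q) r (ℕₚ.≤-trans r≤ (ℕₚ.n≤1+n _)))) (𝔪-* 𝔪-p (Q∈ r)))
      r*Q : 𝔪 1 (ι (suc r) * Q (suc r))
      r*Q = subst (𝔪 1)
        (solve 4 (λ p i x y → p :* x :+ (:- ((p ⊝ i) :* x :+ con 0ℚ :* y)) := i :* x)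
            refl (ι p) (ι (suc r)) (Q (suc r)) (Q r))
        (𝔪-+ (𝔪-* 𝔪-p (Q∈ (suc r))) (𝔪-neg (V∈ (suc r) r≤)))

    -- The coefficient at t^k is the value (y + 1) ⋯ (y + k), which contains the factor y + (j + 1)
    -- = p.
    rise-top-divisible : ∀ y j k → j ℕ.< k → y ℕ.+ suc j ≡ p → 𝔪 1 (rise (1ℚ + ι y) k k)
    rise-top-divisible y j (suc k) (s≤s j≤k) y+j with ℕₚ.m≤n⇒m<n∨m≡n j≤k
    ... | inj₁ j<k = subst (𝔪 1) (sym (rise-top-suc (1ℚ + ι y) k))
      (𝔪-* (𝔪-+ (𝔪-+ (integral-ι 1) (integral-ι y)) (integral-ι k)) (rise-top-divisible y j k j<k y+j))
    ... | inj₂ refl = subst (𝔪 1) (sym (rise-top-suc (1ℚ + ι y) k))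
      (𝔪-* (subst (𝔪 1) factor 𝔪-p) (integral-rise (𝔪-+ (integral-ι 1) (integral-ι y)) k k))
      where
      open ≡-Reasoning
      factor : ι p ≡ 1ℚ + ι y + ι k
      factor = begin
        ι p                ≡⟨ cong ι y+j ⟨
        ι (y ℕ.+ suc k)    ≡⟨ ι-+ y (suc k) ⟩
        ι y + ι (suc k)    ≡⟨ cong (_+_ (ι y)) (ι-suc k) ⟩
        ι y + (1ℚ + ι k)   ≡⟨ solve 2 (λ y k → y :+ (con 1ℚ :+ k) := con 1ℚ :+ y :+ k) refl (ι y) (ι k) ⟩
        1ℚ + ι y + ι k     ∎

    -- The product (y + 1)(y + 2) ⋯ (y + p - 1) has the factor p, and only its extreme coefficients
    -- survive modulo p.
    fermat-wilson : ∀ y → 1 ℕ.≤ y → y ℕ.< p → 𝔪 1 (ι y ^ (2 ℕ.+ q) + ι ((2 ℕ.+ q) !))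
    fermat-wilson y@(suc y-1) _ (s≤s y≤) = subst (𝔪 1)
      (trans (solve 3 (λ a b m → a :+ (b :+ m) :+ (:- m) := a :+ b) refl (Q 0 * E (ι y) k) (Q k * 1ℚ) M)
             (cong₂ _+_ first last))
      (𝔪-+ (subst (𝔪 1) expand value) (𝔪-neg middle))
      where
      open ≡-Reasoning
      k : ℕ
      k = 2 ℕ.+ q
      Q : PowerSeries
      Q = rise 1ℚ k
      M : ℚ
      M = ((Q ∘ suc) ⊛ (E (ι y) ∘ suc)) q
      y∈ : ∀ r → r ℕ.< p → 𝔪 0 (E (ι y) r)
      y∈ = integral-exp (integral-ι y)
      value : 𝔪 1 (rise (1ℚ + ι y) k k)
      value = rise-top-divisible y (k ∸ y) k (ℕₚ.∸-monoʳ-< (s≤s z≤n) y≤)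
        (trans (ℕₚ.+-suc y (k ∸ y)) (cong suc (ℕₚ.m+[n∸m]≡n y≤)))
      expand : rise (1ℚ + ι y) k k ≡ Q 0 * E (ι y) k + (Q k * 1ℚ + M)
      expand = begin
        rise (1ℚ + ι y) k k                      ≡⟨ E-rise (ι y) 1ℚ k k ℕₚ.≤-refl ⟨
        (E (ι y) ⊛ Q) k                          ≡⟨ ⊛-comm (E (ι y)) Q k ⟩
        Q 0 * E (ι y) k + ((Q ∘ suc) ⊛ E (ι y)) (suc q)  ≡⟨ cong (_+_ (Q 0 * E (ι y) k)) (⊛-sucʳ (Q ∘ suc) (E (ι y)) q) ⟩
        Q 0 * E (ι y) k + (Q k * 1ℚ + M)         ∎
      middle : 𝔪 1 M
      middle = ⊛-rel (λ x _ → 𝔪 1 x) 𝔪-+ 𝔪-0 (Q ∘ suc) (Q ∘ suc) (E (ι y) ∘ suc) (E (ι y) ∘ suc) q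
        (λ i j i+j → 𝔪-* (rise-coefficients i (s≤s (ℕₚ.≤-trans (ℕₚ.m≤m+n i j) (ℕₚ.≤-reflexive i+j))))
          (y∈ (suc j) (s≤s (s≤s (ℕₚ.≤-trans (ℕₚ.m≤n+m j i) (ℕₚ.≤-trans (ℕₚ.≤-reflexive i+j) (ℕₚ.n≤1+n q)))))))
      first : Q 0 * E (ι y) k ≡ ι y ^ k
      first = begin
        Q 0 * (ι y ^ k * recip (k !))      ≡⟨ cong (_* (ι y ^ k * recip (k !))) (rise-zero 1ℚ k) ⟩
        ι (k !) * (ι y ^ k * recip (k !))  ≡⟨ solve 3 (λ a b c → a :* (b :* c) := c :* a :* b)
            refl (ι (k !)) (ι y ^ k) (recip (k !)) ⟩
        recip (k !) * ι (k !) * ι y ^ k    ≡⟨ cong (_* ι y ^ k) (recip-cancel (k !) {{ℕₚ._!≢0 k}}) ⟩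
        1ℚ * ι y ^ k                       ≡⟨ ℚₚ.*-identityˡ (ι y ^ k) ⟩
        ι y ^ k                            ∎
      last : Q k * 1ℚ ≡ ι (k !)
      last = trans (ℚₚ.*-identityʳ (Q k)) (rise-top-1 k)

    wilson : ι ((2 ℕ.+ q) !) ≈[ 1 ] - 1ℚ
    wilson = ≈-intro (subst (𝔪 1) (trans (cong (_+ ι (k !)) (1^k≡1 k)) (solve 1 (λ a → con 1ℚ :+ a := a ⊝ con (- 1ℚ))
        refl (ι (k !))))
      (fermat-wilson 1 (s≤s z≤n) (s≤s (s≤s z≤n))))
      where
      k = 2 ℕ.+ q

    fermat : ∀ y → 1 ℕ.≤ y → y ℕ.< p → ι y ^ p ≈[ 1 ] ι y
    fermat y 1≤y y<p = subst₂ (λ a b → a ≈[ 1 ] b) refl (ℚₚ.*-identityʳ (ι y)) (≈-*ˡ (integral-ι y)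
      (≈-trans (≈-intro (subst (𝔪 1) (solve 2 (λ a b → a :+ b := a ⊝ (:- b))
          refl (ι y ^ (2 ℕ.+ q)) (ι ((2 ℕ.+ q) !))) (fermat-wilson y 1≤y y<p)))
               (≈-neg wilson)))

    -- Induction from Wilson's theorem: (a + 1)! b! + a! (b + 1)! = p a! b! if a + b + 2 = p, so
    -- moving one unit between the factorials changes the sign modulo p.
    factorials : ∀ a b → a ℕ.+ b ≡ 2 ℕ.+ q → ι (a !) * ι (b !) ≈[ 1 ] - ((- 1ℚ) ^ a)
    factorials zero    b refl = ≈-trans (≈-reflexive (ℚₚ.*-identityˡ (ι (b !)))) wilson
    factorials (suc a) b eq   = ≈-trans (≈-intro (subst (𝔪 1) pull-p (𝔪-* 𝔪-p (𝔪-* (integral-ι (a !)) (integral-ι (b !))))))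
      (≈-trans (≈-neg (factorials a (suc b) (trans (ℕₚ.+-suc a b) eq)))
               (≈-reflexive (solve 1 (λ e → :- (:- e) := :- (con (- 1ℚ) :* e)) refl ((- 1ℚ) ^ a))))
      where
      open ≡-Reasoning
      pull-p : ι p * (ι (a !) * ι (b !)) ≡ ι (suc a !) * ι (b !) - - (ι (a !) * ι (suc b !))
      pull-p = begin
        ι p * (ι (a !) * ι (b !))
          ≡⟨ cong (λ n → ι n * (ι (a !) * ι (b !))) (trans (cong suc (sym eq)) (sym (ℕₚ.+-suc (suc a) b))) ⟩
        ι (suc a ℕ.+ suc b) * (ι (a !) * ι (b !))
          ≡⟨ cong (_* (ι (a !) * ι (b !))) (ι-+ (suc a) (suc b)) ⟩
        (ι (suc a) + ι (suc b)) * (ι (a !) * ι (b !))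
          ≡⟨ solve 4 (λ a b x y → (a :+ b) :* (x :* y) := a :* x :* y ⊝ (:- (x :* (b :* y))))
              refl (ι (suc a)) (ι (suc b)) (ι (a !)) (ι (b !)) ⟩
        ι (suc a) * ι (a !) * ι (b !) - - (ι (a !) * (ι (suc b) * ι (b !)))
          ≡⟨ cong₂ (λ x y → x * ι (b !) - - (ι (a !) * y)) (ι-!-suc a) (ι-!-suc b) ⟨
        ι (suc a !) * ι (b !) - - (ι (a !) * ι (suc b !)) ∎

    -- The coefficients of W modulo p and p²

    integral-X : ∀ r → r ℕ.< p → 𝔪 0 (X r)
    integral-X r r<p = 𝔪-+ (𝔪-+ (integral-exp (integral-ι 1) r r<p) (integral-exp (𝔪-neg (integral-ι 1)) r r<p)) (𝔪-neg (𝟏∈ r))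
      where
      𝟏∈ : ∀ r → 𝔪 0 (𝟏 r)
      𝟏∈ zero    = integral-ι 1
      𝟏∈ (suc r) = 𝔪-0

    integral-w : ∀ r → r ℕ.≤ 2 ℕ.+ q → 𝔪 0 (w p r)
    integral-w = 𝔪-⊛-divide (2 ℕ.+ q) X (w p) refl (λ r r≤ → integral-X r (s≤s r≤))
      (λ r r≤ → subst (𝔪 0) (sym (X-w p r (s≤s r≤)))
        (𝔪-* (integral-recip (p∤! (ℕₚ.n<1+n (2 ℕ.+ q)))) (integral-rise (integral-ι 1) (2 ℕ.+ q) r)))

    X-w-zero : (X ⊛ w p) 0 ≡ 1ℚ
    X-w-zero = begin
      (X ⊛ w p) 0                  ≡⟨ X-w p 0 (s≤s z≤n) ⟩
      recip (k !) * rise 1ℚ k 0    ≡⟨ cong (recip (k !) *_) (rise-zero 1ℚ k) ⟩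
      recip (k !) * ι (k !)        ≡⟨ recip-cancel (k !) {{ℕₚ._!≢0 k}} ⟩
      1ℚ                           ∎
      where
      open ≡-Reasoning
      k = 2 ℕ.+ q

    -- Together with `X-w-zero`: modulo p and up to t^(p-2), `X ⊛ w p` is the series 1. The other
    -- term of C(y + p - 1, p - 1), its constant term, sits at t^(p-1).
    X-w-suc : ∀ r → suc r ℕ.≤ 1 ℕ.+ q → 𝔪 1 ((X ⊛ w p) (suc r))
    X-w-suc r r≤ = subst (𝔪 1) (sym (X-w p (suc r) (s≤s (ℕₚ.≤-trans r≤ (ℕₚ.n≤1+n _)))))
      (𝔪-* (integral-recip (p∤! (ℕₚ.n<1+n (2 ℕ.+ q)))) (rise-coefficients r r≤))

    -1^p : (- 1ℚ) ^ p ≡ - 1ℚ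
    -1^p = -1^-odd 2∤p
      where
      2∤p : 2 ∤ p
      2∤p 2∣p with prime⇒irreducible p-prime 2∣p
      ... | inj₁ ()
      ... | inj₂ ()

    -- The range stops at p - 2 because ε has the coefficient 1 / p! at t^(p-1).
    integral-β : ∀ r → r ℕ.≤ 1 ℕ.+ q → 𝔪 0 (β r)
    integral-β = 𝔪-⊛-divide (1 ℕ.+ q) ε β refl integral-ε
      (λ r r≤ → subst (𝔪 0) (sym (ε-β r)) (integral-exp (integral-recip (p∤< 3<p)) r (s≤s (ℕₚ.≤-trans r≤
          (ℕₚ.n≤1+n _)))))

    ≈-*ʳ : ∀ {s x y c} → 𝔪 0 c → x ≈[ s ] y → x * c ≈[ s ] y * c
    ≈-*ʳ {s} {x} {y} {c} c∈ x≈y = subst₂ (λ u v → u ≈[ s ] v) (ℚₚ.*-comm c x) (ℚₚ.*-comm c y) (≈-*ˡ c∈ x≈y)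

    -- p - 1 is even, so the reflected series encodes W(- y), which equals W(y - p). At t^(r+1) this
    -- reads (-1)^(r+1) w_(r+1) = w_(r+1) - p w_r + ⋯, where the omitted terms contain p² and
    -- factorials prime to p. The odd sign doubles w_(r+1).
    w-reflect : ∀ r → suc r ℕ.≤ 2 ℕ.+ q → (- 1ℚ) ^ suc r ≡ - 1ℚ → ι 2 * w p (suc r) ≈[ 2 ] ι p * w p r
    w-reflect r r<k odd = ≈-intro (subst (𝔪 2) (solve 4
        (λ w v pv m → :- (con (- 1ℚ) :* w ⊝ (con 1ℚ :* w :+ m) :+ (m ⊝ (:- pv))) := con (ι 2) :* w ⊝ pv)
        refl (w p (suc r)) (w p r) (ι p * w p r) M)
      (𝔪-neg (𝔪-+ (subst (λ e → 𝔪 2 (e * w p (suc r) - (1ℚ * w p (suc r) + M))) odd reflected) (second r r<k))))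
      where
      e : PowerSeries
      e = E (- ι p)
      M : ℚ
      M = ((e ∘ suc) ⊛ w p) r
      -p∈ : 𝔪 1 (- ι p)
      -p∈ = 𝔪-neg 𝔪-p
      reflected : 𝔪 2 ((σ (- 1ℚ) (w p) ⊕ ⊖ (e ⊛ w p)) (suc r))
      reflected = 𝔪-⊛-divide (2 ℕ.+ q) X (σ (- 1ℚ) (w p) ⊕ ⊖ (e ⊛ w p)) refl (λ r r≤ → integral-X r (s≤s r≤))
        (λ r r≤ → subst (𝔪 2) (sym (trans
          (solveₛ 3 (λ x s u → x ⊠ (s ⊞ ⊟ u) ≐ x ⊠ s ⊞ ⊟ (x ⊠ u)) (λ _ → refl) X (σ (- 1ℚ) (w p)) (e ⊛ w p) r)
          (trans (cong (_- (X ⊛ (e ⊛ w p)) r) (X-w-reflect (2 ℕ.+ q) r r≤)) (ℚₚ.+-inverseʳ ((X ⊛ (e ⊛ w p)) r))))) 𝔪-0)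
        (suc r) r<k
      second : ∀ r → suc r ℕ.≤ 2 ℕ.+ q → 𝔪 2 (((e ∘ suc) ⊛ w p) r - - (ι p * w p r))
      second zero    _ = subst (𝔪 2) (solve 2 (λ p w → con 0ℚ
          := (:- p) :* con 1ℚ :* con 1ℚ :* w :+ con 0ℚ ⊝ (:- (p :* w))) refl (ι p) (w p 0)) 𝔪-0
      second (suc r) r<k = subst (𝔪 2) (solve 3 (λ p w m → m := (:- p) :* con 1ℚ :* con 1ℚ :* w :+ m ⊝ (:- (p :* w)))
          refl (ι p) (w p (suc r)) (((e ∘ suc ∘ suc) ⊛ w p) r))
        (⊛-rel (λ x _ → 𝔪 2 x) 𝔪-+ 𝔪-0 (e ∘ suc ∘ suc) (e ∘ suc ∘ suc) (w p) (w p) r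
          (λ i j i+j → subst (𝔪 2) (ℚₚ.*-comm (w p j) (e (2 ℕ.+ i))) (𝔪-* (integral-w j (bound-j i j i+j)) (e∈ i (bound-i i j i+j)))))
        where
        bound-j : ∀ i j → i ℕ.+ j ≡ r → j ℕ.≤ 2 ℕ.+ q
        bound-j i j i+j = ℕₚ.≤-trans (ℕₚ.m≤n+m j i) (ℕₚ.≤-trans (ℕₚ.≤-reflexive i+j) (ℕₚ.≤-trans (ℕₚ.n≤1+n r)
            (ℕₚ.<⇒≤ r<k)))
        bound-i : ∀ i j → i ℕ.+ j ≡ r → 2 ℕ.+ i ℕ.< p
        bound-i i j i+j = s≤s (ℕₚ.≤-trans (s≤s (s≤s (ℕₚ.≤-trans (ℕₚ.m≤m+n i j) (ℕₚ.≤-reflexive i+j)))) r<k)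
        e∈ : ∀ i → 2 ℕ.+ i ℕ.< p → 𝔪 2 (e (2 ℕ.+ i))
        e∈ i 2+i<p = subst (𝔪 2) (solve 3 (λ x y z → x :* (x :* (y :* z)) := x :* (x :* y) :* z)
            refl (- ι p) ((- ι p) ^ i) (recip ((2 ℕ.+ i) !)))
          (𝔪-* -p∈ (𝔪-* -p∈ (𝔪-* (𝔪-^ (𝔪-neg (integral-ι p)) i) (integral-recip (p∤! 2+i<p)))))

    -- Modulo p and up to t^(p-2), both 3 W and the negated tail of `Y` are 3 / X.
    w-Y : ∀ r → r ℕ.≤ 1 ℕ.+ q → 𝔪 1 (ι 3 * w p r + Y (suc r))
    w-Y = 𝔪-⊛-divide (1 ℕ.+ q) X f refl (λ r r≤ → integral-X r (s≤s (ℕₚ.≤-trans r≤ (ℕₚ.n≤1+n _))))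
      (λ r r≤ → subst (𝔪 1) (sym (X-f r)) (X-f∈ r r≤))
      where
      f : PowerSeries
      f r = ι 3 * w p r + Y (suc r)
      X-f : ∀ r → (X ⊛ f) r ≡ ι 3 * (X ⊛ w p) r + - ι 3 * 𝟏 r
      X-f r = trans (⊛-distribˡ X (λ r → ι 3 * w p r) (Y ∘ suc) r)
        (cong₂ _+_ (trans (⊛-comm X (λ r → ι 3 * w p r) r) (trans (⊛-scale (ι 3) (w p) X r)
            (cong (ι 3 *_) (⊛-comm (w p) X r)))) (X-Y-tail r))
      X-f∈ : ∀ r → r ℕ.≤ 1 ℕ.+ q → 𝔪 1 (ι 3 * (X ⊛ w p) r + - ι 3 * 𝟏 r)
      X-f∈ zero    _  = subst (λ x → 𝔪 1 (ι 3 * x + - ι 3 * 1ℚ)) (sym X-w-zero) 𝔪-0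
      X-f∈ (suc r) r≤ = 𝔪-+ (𝔪-* (integral-ι 3) (X-w-suc r r≤)) 𝔪-0

    -- With N = n + 1 and m = p - N, the factor 6^N makes the exponents add up to p: 6^N (3^m + 6^m)
    -- = 3^p (2^N + 2^p), which is 3 (2^N + 2) modulo p by Fermat. The factor n! is matched with the
    -- m! in `bernoulli`, since n! m! ≡ 1 for odd n with n + m = p - 1.
    w-bernoulli : ∀ n r → suc n ℕ.+ r ≡ 2 ℕ.+ q → (- 1ℚ) ^ suc n ≡ 1ℚ →
      ι 6 ^ suc n * w p r ≈[ 1 ] - (ι 2 * (ι 2 ^ suc n + ι 2)) * ι (n !) * bernoulli (suc r) (+ 1 / 3)
    w-bernoulli n r n+r even = ≈-cancel 3 (p∤< 3<p) (≈-trans step₁ (≈-trans step₂ step₃))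
      where
      open ≡-Reasoning
      N m : ℕ
      N = suc n
      m = suc r
      N+m : N ℕ.+ m ≡ p
      N+m = trans (ℕₚ.+-suc N r) (cong suc n+r)
      odd : (- 1ℚ) ^ m ≡ - 1ℚ
      odd = begin
        (- 1ℚ) ^ m                   ≡⟨ ℚₚ.*-identityˡ ((- 1ℚ) ^ m) ⟨
        1ℚ * (- 1ℚ) ^ m              ≡⟨ cong (_* (- 1ℚ) ^ m) even ⟨
        (- 1ℚ) ^ N * (- 1ℚ) ^ m      ≡⟨ Expℚ.^-homo-* (- 1ℚ) N m ⟨
        (- 1ℚ) ^ (N ℕ.+ m)           ≡⟨ cong ((- 1ℚ) ^_) N+m ⟩
        (- 1ℚ) ^ p                   ≡⟨ -1^p ⟩
        - 1ℚ                         ∎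
      r≤ : suc r ℕ.≤ 2 ℕ.+ q
      r≤ = ℕₚ.≤-trans (s≤s (ℕₚ.m≤n+m r n)) (ℕₚ.≤-reflexive n+r)
      m≤ : ∀ n → (- 1ℚ) ^ suc n ≡ 1ℚ → suc n ℕ.+ r ≡ 2 ℕ.+ q → m ℕ.≤ 1 ℕ.+ q
      -- N is even, so N = 1 is impossible; thus m ≤ p - 2, the range of `integral-β`.
      m≤ zero    () _
      m≤ (suc n) _  eq = ℕₚ.≤-trans (s≤s (ℕₚ.m≤n+m r n)) (ℕₚ.≤-reflexive (ℕₚ.suc-injective eq))
      β∈ : 𝔪 0 (β m)
      β∈ = integral-β m (m≤ n even n+r)
      step₁ : ι 3 * (ι 6 ^ N * w p r) ≈[ 1 ] - (ι 2 * (ι 2 ^ N * ι 3 ^ p + ι 2 ^ p * ι 3 ^ p)) * β m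
      step₁ = ≈-intro (subst (𝔪 1) (begin
        ι 6 ^ N * (ι 3 * w p r + Y m)
          ≡⟨ cong (λ y → ι 6 ^ N * (ι 3 * w p r + y)) (Y-odd m odd) ⟩
        ι 6 ^ N * (ι 3 * w p r + ι 2 * (ι 3 ^ m + ι 6 ^ m) * β m)
          ≡⟨ solve 5 (λ s w x y b → s :* (con (ι 3) :* w :+ con (ι 2) :* (x :+ y) :* b)
              := con (ι 3) :* (s :* w) ⊝ (:- (con (ι 2) :* (s :* x :+ s :* y))) :* b) refl
               (ι 6 ^ N) (w p r) (ι 3 ^ m) (ι 6 ^ m) (β m) ⟩
        ι 3 * (ι 6 ^ N * w p r) - - (ι 2 * (ι 6 ^ N * ι 3 ^ m + ι 6 ^ N * ι 6 ^ m)) * β m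
          ≡⟨ cong₂ (λ x y → ι 3 * (ι 6 ^ N * w p r) - - (ι 2 * (x + y)) * β m) 6^N3^m 6^N6^m ⟩
        ι 3 * (ι 6 ^ N * w p r) - - (ι 2 * (ι 2 ^ N * ι 3 ^ p + ι 2 ^ p * ι 3 ^ p)) * β m ∎)
        (𝔪-* (𝔪-^ (integral-ι 6) N) (w-Y r (ℕₚ.≤-pred r≤))))
        where
        6^ : ∀ n → ι 6 ^ n ≡ ι 2 ^ n * ι 3 ^ n
        6^ n = Expℚ.^-distrib-* (ι 2) (ι 3) n
        merge : ∀ a → a ^ N * a ^ m ≡ a ^ p
        merge a = trans (sym (Expℚ.^-homo-* a N m)) (cong (a ^_) N+m)
        6^N3^m : ι 6 ^ N * ι 3 ^ m ≡ ι 2 ^ N * ι 3 ^ p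
        6^N3^m = trans (cong (_* ι 3 ^ m) (6^ N)) (trans (ℚₚ.*-assoc (ι 2 ^ N) (ι 3 ^ N) (ι 3 ^ m))
            (cong (ι 2 ^ N *_) (merge (ι 3))))
        6^N6^m : ι 6 ^ N * ι 6 ^ m ≡ ι 2 ^ p * ι 3 ^ p
        6^N6^m = trans (merge (ι 6)) (6^ p)
      2^p : ι 2 ^ p ≈[ 1 ] ι 2
      2^p = fermat 2 (s≤s z≤n) (s≤s (s≤s (s≤s z≤n)))
      3^p : ι 3 ^ p ≈[ 1 ] ι 3
      3^p = fermat 3 (s≤s z≤n) 3<p
      step₂ : - (ι 2 * (ι 2 ^ N * ι 3 ^ p + ι 2 ^ p * ι 3 ^ p)) * β m ≈[ 1 ] - (ι 2 * (ι 2 ^ N * ι 3 + ι 2 * ι 3)) * β m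
      step₂ = ≈-*ʳ β∈ (≈-neg (≈-*ˡ (integral-ι 2) (≈-+ (≈-*ˡ (𝔪-^ (integral-ι 2) N) 3^p)
        (≈-trans (≈-*ˡ (𝔪-^ (integral-ι 2) p) 3^p) (≈-*ʳ (integral-ι 3) 2^p)))))
      factorial≈1 : ι (n !) * ι (m !) ≈[ 1 ] 1ℚ
      factorial≈1 = ≈-trans (factorials n m (trans (ℕₚ.+-suc n r) n+r))
        (≈-reflexive (trans (solve 1 (λ e → :- e := con (- 1ℚ) :* e) refl ((- 1ℚ) ^ n)) even))
      step₃ : - (ι 2 * (ι 2 ^ N * ι 3 + ι 2 * ι 3)) * β m ≈[ 1 ] ι 3 * (- (ι 2 * (ι 2 ^ N + ι 2)) * ι (n !) * (ι (m !) * β m))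
      step₃ = subst₂ (λ x y → x ≈[ 1 ] y)
        (solve 2 (λ t b → :- (con (ι 2) :* (t :* con (ι 3) :+ con (ι 2) :* con (ι 3))) :* b :* con 1ℚ
            := :- (con (ι 2) :* (t :* con (ι 3) :+ con (ι 2) :* con (ι 3))) :* b) refl (ι 2 ^ N) (β m))
        (solve 4 (λ t b x y → :- (con (ι 2) :* (t :* con (ι 3) :+ con (ι 2) :* con (ι 3))) :* b :* (x :* y)
           := con (ι 3) :* (:- (con (ι 2) :* (t :+ con (ι 2))) :* x :* (y :* b)))
               refl (ι 2 ^ N) (β m) (ι (n !)) (ι (m !)))
        (≈-sym (≈-*ˡ (𝔪-* (𝔪-neg (𝔪-* (integral-ι 2) (𝔪-+ (𝔪-* (𝔪-^ (integral-ι 2) N) (integral-ι 3)) (integral-ι 6)))) β∈) factorial≈1))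

    -- Integrality of both sides and the two cases

    p∤^ : ∀ {m} → p ∤ m → ∀ n → p ∤ m ℕ.^ n
    p∤^ p∤m zero    = p∤1
    p∤^ p∤m (suc n) = p∤* p∤m (p∤^ p∤m n)

    p∤6 : p ∤ 6
    p∤6 = p∤* {2} {3} (p∤< (s≤s (s≤s (s≤s z≤n)))) (p∤< 3<p)

    integral-cancel : ∀ k .{{_ : ℕ.NonZero k}} {x} → p ∤ k → 𝔪 0 (ι k * x) → 𝔪 0 x
    integral-cancel k {x} p∤k kx∈ = ≈⇒𝔪 (≈-cancel k p∤k (≈-trans (𝔪⇒≈ kx∈) (≈-reflexive (sym (ℚₚ.*-zeroʳ (ι k))))))

    integral-bernoulli : ∀ m → m ℕ.≤ 1 ℕ.+ q → 𝔪 0 (bernoulli m (+ 1 / 3))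
    integral-bernoulli m m≤ = 𝔪-* (integral-ι (m !)) (integral-β m m≤)

    -- Read off from the integral coefficient of `w p`, where the sum appears multiplied by a
    -- factorial prime to p.
    integral-legendreSum : ∀ n r → suc r ℕ.+ suc n ≡ p → 𝔪 0 (legendreSum (suc n) p)
    integral-legendreSum n r r+n = integral-cancel (suc n !) {{ℕₚ._!≢0 (suc n)}} (p∤! n<p)
      (subst (𝔪 0) (legendreSum-w p n r -1^p r+n) (integral-w r r≤))
      where
      n<p : suc n ℕ.< p
      n<p = ℕₚ.≤-trans (s≤s (ℕₚ.m≤n+m (suc n) r)) (ℕₚ.≤-reflexive r+n)
      r≤ : r ℕ.≤ 2 ℕ.+ q
      r≤ = ℕₚ.≤-trans (ℕₚ.m≤m+n r (suc n)) (ℕₚ.≤-reflexive (ℕₚ.suc-injective r+n))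

    integral-/ : ∀ a d .{{_ : ℕ.NonZero d}} → p ∤ d → 𝔪 0 (a / d)
    integral-/ a d p∤d = integral-cancel d p∤d
      (subst (𝔪 0) (sym (trans (ℚₚ.*-comm (ι d) (a / d)) (/-cancel a d))) (integral-ιᶻ a))

    ≈⇒mod : ∀ {x y} s → 𝔪 0 x → 𝔪 0 y → x ≈[ s ] y → x ≡ y [mod p-prime ^ s ]
    ≈⇒mod {x} {y} s x∈ y∈ (≈-intro (𝔪-intro d p∤d a eq)) = record
      { integralˡ = 𝔪⇒∤↧ x∈
      ; integralʳ = 𝔪⇒∤↧ y∈
      ; congruent = 𝔪⇒∤↧ {(x - y) * p^-s} (𝔪-intro d p∤d a (begin
          (x - y) * p^-s * ι d          ≡⟨ solve 3 (λ a b c → a :* b :* c := b :* (a :* c)) refl (x - y) p^-s (ι d) ⟩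
          p^-s * ((x - y) * ι d)        ≡⟨ cong (p^-s *_) eq ⟩
          p^-s * (ι (p ℕ.^ s) * ιᶻ a)   ≡⟨ ℚₚ.*-assoc p^-s (ι (p ℕ.^ s)) (ιᶻ a) ⟨
          p^-s * ι (p ℕ.^ s) * ιᶻ a     ≡⟨ cong (_* ιᶻ a) (/-cancel (+ 1) (p ℕ.^ s)) ⟩
          1ℚ * ιᶻ a                     ∎))
      }
      where
      open ≡-Reasoning
      instance
        p^s≢0 : ℕ.NonZero (p ℕ.^ s)
        p^s≢0 = ℕₚ.m^n≢0 p s
      p^-s : ℚ
      p^-s = + 1 / (p ℕ.^ s)

    -- Here the n of the theorem is N = n + 1. As 6^N N! = n! (N 6^N), cancelling n! (N 6^N) turns
    -- `w-bernoulli` into the claim. The index m comes with an equation so that the truncated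
    -- subtraction of the theorem can be supplied for it.
    even-case : ∀ n r m → m ≡ suc r → suc n ℕ.+ r ≡ 2 ℕ.+ q → (- 1ℚ) ^ suc n ≡ 1ℚ
        → .{{_ : ℕ.NonZero (suc n ℕ.* 6 ℕ.^ suc n)}} →
      legendreSum (suc n) p
        ≡ - (+ (2 ℕ.^ (suc n ℕ.+ 1) ℕ.+ 4) / (suc n ℕ.* 6 ℕ.^ suc n)) * bernoulli m (+ 1 / 3) [mod p-prime ^ 1 ]
    even-case n r _ refl n+r even = ≈⇒mod 1 (integral-legendreSum n r r+n)
      (𝔪-* (𝔪-neg (integral-/ (+ a) d p∤d)) (integral-bernoulli (suc r) (m≤ n even n+r)))
      (≈-cancel (n ! ℕ.* d) (p∤* {n !} {d} (p∤! (ℕₚ.<⇒≤ n<p)) p∤d)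
        (subst₂ (λ x y → x ≈[ 1 ] y) left right (w-bernoulli n r n+r even)))
      where
      open ≡-Reasoning
      N a d : ℕ
      N = suc n
      a = 2 ℕ.^ (N ℕ.+ 1) ℕ.+ 4
      d = N ℕ.* 6 ℕ.^ N
      S B : ℚ
      S = legendreSum N p
      B = bernoulli (suc r) (+ 1 / 3)
      r+n : suc r ℕ.+ N ≡ p
      r+n = cong suc (trans (ℕₚ.+-comm r N) n+r)
      n<p : N ℕ.< p
      n<p = s≤s (ℕₚ.≤-trans (ℕₚ.m≤m+n N r) (ℕₚ.≤-reflexive n+r))
      m≤ : ∀ n → (- 1ℚ) ^ suc n ≡ 1ℚ → suc n ℕ.+ r ≡ 2 ℕ.+ q → suc r ℕ.≤ 1 ℕ.+ q
      m≤ zero    () _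
      m≤ (suc n) _  eq = ℕₚ.≤-trans (s≤s (ℕₚ.m≤n+m r n)) (ℕₚ.≤-reflexive (ℕₚ.suc-injective eq))
      p∤d : p ∤ d
      p∤d = p∤* {N} {6 ℕ.^ N} (p∤< n<p) (p∤^ p∤6 N)
      ι-a : ι a ≡ ι 2 * (ι 2 ^ N + ι 2)
      ι-a = begin
        ι (2 ℕ.^ (N ℕ.+ 1) ℕ.+ 4)      ≡⟨ ι-+ (2 ℕ.^ (N ℕ.+ 1)) 4 ⟩
        ι (2 ℕ.^ (N ℕ.+ 1)) + ι 4      ≡⟨ cong (λ k → ι (2 ℕ.^ k) + ι 4) (ℕₚ.+-comm N 1) ⟩
        ι (2 ℕ.^ suc N) + ι 4          ≡⟨ cong (_+ ι 4) (ι-^ 2 (suc N)) ⟩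
        ι 2 * ι 2 ^ N + ι 4            ≡⟨ solve 1 (λ x → con (ι 2) :* x :+ con (ι 4) := con (ι 2) :* (x :+ con (ι 2)))
            refl (ι 2 ^ N) ⟩
        ι 2 * (ι 2 ^ N + ι 2)          ∎
      left : ι 6 ^ N * w p r ≡ ι (n ! ℕ.* d) * S
      left = begin
        ι 6 ^ N * w p r                           ≡⟨ cong₂ _*_ (sym (ι-^ 6 N)) (legendreSum-w p n r -1^p r+n) ⟩
        ι (6 ℕ.^ N) * (ι (N !) * S)               ≡⟨ cong (λ x → ι (6 ℕ.^ N) * (x * S)) (ι-!-suc n) ⟩
        ι (6 ℕ.^ N) * (ι N * ι (n !) * S)         ≡⟨ solve 4 (λ a b c s → a :* (b :* c :* s) := c :* (b :* a) :* s)
            refl (ι (6 ℕ.^ N)) (ι N) (ι (n !)) S ⟩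
        ι (n !) * (ι N * ι (6 ℕ.^ N)) * S         ≡⟨ cong (_* S) (trans (ι-* (n !) d)
            (cong (ι (n !) *_) (ι-* N (6 ℕ.^ N)))) ⟨
        ι (n ! ℕ.* d) * S                         ∎
      right : - (ι 2 * (ι 2 ^ N + ι 2)) * ι (n !) * B ≡ ι (n ! ℕ.* d) * (- (+ a / d) * B)
      right = begin
        - (ι 2 * (ι 2 ^ N + ι 2)) * ι (n !) * B     ≡⟨ cong (λ x → - x * ι (n !) * B) (trans (sym ι-a)
            (sym (/-cancel (+ a) d))) ⟩
        - ((+ a / d) * ι d) * ι (n !) * B           ≡⟨ solve 4 (λ a d n b → (:- (a :* d)) :* n :* b
            := n :* d :* ((:- a) :* b)) refl (+ a / d) (ι d) (ι (n !)) B ⟩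
        ι (n !) * ι d * (- (+ a / d) * B)           ≡⟨ cong (_* (- (+ a / d) * B)) (ι-* (n !) d) ⟨
        ι (n ! ℕ.* d) * (- (+ a / d) * B)           ∎

    -- For the odd index n + 1, `w-reflect` leads to the neighbouring coefficient, that of the even
    -- index N = n + 2. `w-bernoulli` gives it modulo p, and the factor p raises this to modulo p².
    -- The number cancelled at the end is 2 (n + 1)! 6^N.
    odd-case : ∀ n r m → m ≡ suc r → suc (suc n) ℕ.+ r ≡ 2 ℕ.+ q → (- 1ℚ) ^ suc n ≡ - 1ℚ
        → .{{_ : ℕ.NonZero (6 ℕ.^ (suc n ℕ.+ 1))}} →
      legendreSum (suc n) p
        ≡ - (+ (2 ℕ.^ (suc n ℕ.+ 1) ℕ.+ 2) / (6 ℕ.^ (suc n ℕ.+ 1))) * (+ p / 1) * bernoulli m (+ 1 / 3) [mod p-prime ^ 2 ]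
    odd-case n r _ refl n+r odd = ≈⇒mod 2 (integral-legendreSum n (suc r) r+n)
      (𝔪-* (𝔪-* (𝔪-neg (integral-/ (+ a) d (p∤^ p∤6 (suc n ℕ.+ 1)))) (integral-ι p)) (integral-bernoulli (suc r) m≤))
      (≈-cancel k (p∤* {2 ℕ.* suc n !} {d} (p∤* {2} {suc n !} (p∤< (s≤s (s≤s (s≤s z≤n)))) (p∤! n<p)) (p∤^ p∤6 (suc n ℕ.+ 1)))
        (≈-trans (subst₂ (λ x y → x ≈[ 2 ] y) left middle (≈-*ˡ (𝔪-^ (integral-ι 6) N) (w-reflect r r<k sign)))
                 (subst₂ (λ x y → x ≈[ 2 ] y) refl right (≈-*ˡ 𝔪-p (w-bernoulli (suc n) r n+r even)))))
      where
      open ≡-Reasoning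
      N a d k : ℕ
      N = suc (suc n)
      a = 2 ℕ.^ (suc n ℕ.+ 1) ℕ.+ 2
      d = 6 ℕ.^ (suc n ℕ.+ 1)
      k = 2 ℕ.* suc n ! ℕ.* d
      S B : ℚ
      S = legendreSum (suc n) p
      B = bernoulli (suc r) (+ 1 / 3)
      r+N : r ℕ.+ N ≡ 2 ℕ.+ q
      r+N = trans (ℕₚ.+-comm r N) n+r
      r+n : suc (suc r) ℕ.+ suc n ≡ p
      r+n = cong suc (trans (sym (ℕₚ.+-suc r (suc n))) r+N)
      n<p : suc n ℕ.< p
      n<p = ℕₚ.≤-trans (ℕₚ.≤-trans (ℕₚ.m≤m+n N r) (ℕₚ.≤-reflexive n+r)) (ℕₚ.n≤1+n _)
      r<k : suc r ℕ.≤ 2 ℕ.+ q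
      r<k = ℕₚ.≤-trans (s≤s (ℕₚ.m≤n+m r (suc n))) (ℕₚ.≤-reflexive n+r)
      m≤ : suc r ℕ.≤ 1 ℕ.+ q
      m≤ = ℕₚ.≤-trans (s≤s (ℕₚ.m≤n+m r n)) (ℕₚ.≤-reflexive (ℕₚ.suc-injective n+r))
      even : (- 1ℚ) ^ N ≡ 1ℚ
      even = cong (- 1ℚ *_) odd
      sign : (- 1ℚ) ^ suc r ≡ - 1ℚ
      sign = begin
        (- 1ℚ) ^ suc r                     ≡⟨ ℚₚ.*-identityˡ ((- 1ℚ) ^ suc r) ⟨
        1ℚ * (- 1ℚ) ^ suc r                ≡⟨ cong (_* (- 1ℚ) ^ suc r) even ⟨
        (- 1ℚ) ^ N * (- 1ℚ) ^ suc r        ≡⟨ Expℚ.^-homo-* (- 1ℚ) N (suc r) ⟨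
        (- 1ℚ) ^ (N ℕ.+ suc r)             ≡⟨ cong ((- 1ℚ) ^_) (trans (ℕₚ.+-suc N r) (cong suc n+r)) ⟩
        (- 1ℚ) ^ p                         ≡⟨ -1^p ⟩
        - 1ℚ                               ∎
      ι-a : ι a ≡ ι 2 ^ N + ι 2
      ι-a = trans (ι-+ (2 ℕ.^ (suc n ℕ.+ 1)) 2) (cong (_+ ι 2) (trans (ι-^ 2 (suc n ℕ.+ 1)) (cong (ι 2 ^_)
          (ℕₚ.+-comm (suc n) 1))))
      ι-d : ι d ≡ ι 6 ^ N
      ι-d = trans (ι-^ 6 (suc n ℕ.+ 1)) (cong (ι 6 ^_) (ℕₚ.+-comm (suc n) 1))
      ι-k : ι k ≡ ι 2 * ι (suc n !) * ι d
      ι-k = trans (ι-* (2 ℕ.* suc n !) d) (cong (_* ι d) (ι-* 2 (suc n !)))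
      left : ι 6 ^ N * (ι 2 * w p (suc r)) ≡ ι k * S
      left = begin
        ι 6 ^ N * (ι 2 * w p (suc r))           ≡⟨ cong₂ (λ x y → x * (ι 2 * y))
            (sym ι-d) (legendreSum-w p n (suc r) -1^p r+n) ⟩
        ι d * (ι 2 * (ι (suc n !) * S))         ≡⟨ solve 4 (λ d t f s → d :* (t :* (f :* s)) := t :* f :* d :* s)
            refl (ι d) (ι 2) (ι (suc n !)) S ⟩
        ι 2 * ι (suc n !) * ι d * S             ≡⟨ cong (_* S) ι-k ⟨
        ι k * S                                 ∎
      middle : ι 6 ^ N * (ι p * w p r) ≡ ι p * (ι 6 ^ N * w p r)
      middle = solve 3 (λ a b c → a :* (b :* c) := b :* (a :* c)) refl (ι 6 ^ N) (ι p) (w p r)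
      right : ι p * (- (ι 2 * (ι 2 ^ N + ι 2)) * ι (suc n !) * B) ≡ ι k * (- (+ a / d) * ι p * B)
      right = begin
        ι p * (- (ι 2 * (ι 2 ^ N + ι 2)) * ι (suc n !) * B)
          ≡⟨ cong (λ x → ι p * (- (ι 2 * x) * ι (suc n !) * B)) (trans (sym ι-a) (sym (/-cancel (+ a) d))) ⟩
        ι p * (- (ι 2 * ((+ a / d) * ι d)) * ι (suc n !) * B)
          ≡⟨ solve 6 (λ p t a d f b → p :* ((:- (t :* (a :* d))) :* f :* b) := t :* f :* d :* ((:- a) :* p :* b))
              refl (ι p) (ι 2) (+ a / d) (ι d) (ι (suc n !)) B ⟩
        ι 2 * ι (suc n !) * ι d * (- (+ a / d) * ι p * B)
          ≡⟨ cong (_* (- (+ a / d) * ι p * B)) ι-k ⟨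
        ι k * (- (+ a / d) * ι p * B) ∎

open import Data.Integer.Base using (+_)
open import Data.Nat.Base using (ℕ; NonZero; _+_; _*_; _^_; _∸_; _⊔_; _<_)
open import Data.Nat.Divisibility using (_∣_; _∤_)
open import Data.Nat.Primality using (Prime)
open import Data.Nat.Properties using (m^n≢0; m*n≢0)
open import Data.Product.Base using (_×_)
open import Data.Rational.Base as ℚ using (-_; _/_)
open import Defs using (legendreSum; bernoulli; _≡_[mod_^_])

open import Data.Nat.Base using (zero; suc; _≤_; s≤s; ≢-nonZero⁻¹)
open import Data.Nat.Primality using (¬prime[1])
import Data.Nat.Properties as ℕₚ
open import Data.Product.Base using (_,_)
open import Relation.Binary.PropositionalEquality using (refl; trans; cong)
open import Relation.Nullary.Negation using (contradiction)

theorem3p3 : (n : ℕ) .{{n≢0 : NonZero n}} (p : ℕ) (p-prime : Prime p) →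
    (n + 1) ⊔ 3 < p →
    (2 ∤ n →
    legendreSum n p
    ≡ - (_/_ (+ (2 ^ (n + 1) + 2)) (6 ^ (n + 1)) {{m^n≢0 6 (n + 1)}})
    ℚ.* (+ p / 1) ℚ.* bernoulli (p ∸ n ∸ 1) (+ 1 / 3)
    [mod p-prime ^ 2 ])
    ×
    (2 ∣ n →
    legendreSum n p
    ≡ - (_/_ (+ (2 ^ (n + 1) + 4)) (n * 6 ^ n) {{m*n≢0 n (6 ^ n) {{n≢0}} {{m^n≢0 6 n}}}})
    ℚ.* bernoulli (p ∸ n) (+ 1 / 3)
    [mod p-prime ^ 1 ])
theorem3p3 zero {{n≢0}} _ _ _ = contradiction refl (≢-nonZero⁻¹ 0 {{n≢0}})
theorem3p3 (suc n) 0 _ ()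
theorem3p3 (suc n) 1 p-prime _ = contradiction p-prime ¬prime[1]
theorem3p3 (suc n) 2 _ bound with ℕₚ.≤-trans (s≤s (ℕₚ.m≤n⊔m (suc n + 1) 3)) bound
... | s≤s (s≤s ())
theorem3p3 (suc n) (suc (suc (suc q))) p-prime bound =
  -- r = q - n solves (n + 2) + r = p - 1, and then r + 1 is p - (n + 1) - 1, the Bernoulli index.
  (λ 2∤n → odd-case n (q ∸ n) (3 + q ∸ suc n ∸ 1) (cong (_∸ 1) (ℕₚ.+-∸-assoc 2 n≤q))
    (cong (_+_ 2) (ℕₚ.m+[n∸m]≡n n≤q)) (Proof.-1^-odd 2∤n) {{m^n≢0 6 (suc n + 1)}}) ,
  (λ 2∣n → even-case n (suc (q ∸ n)) (3 + q ∸ suc n) (ℕₚ.+-∸-assoc 2 n≤q)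
    (cong suc (trans (ℕₚ.+-suc n (q ∸ n)) (cong suc (ℕₚ.m+[n∸m]≡n n≤q)))) (Proof.-1^-even 2∣n)
    {{m*n≢0 (suc n) (6 ^ suc n) {{_}} {{m^n≢0 6 (suc n)}}}})
  where
  open Proof.Adic p-prime (ℕₚ.≤-trans (s≤s (ℕₚ.m≤n⊔m (suc n + 1) 3)) bound) using (odd-case; even-case)
  -- The bound contains n + 2 < q + 3, the n of the theorem being n + 1 here.
  n≤q : n ≤ q
  n≤q = ℕₚ.≤-pred (ℕₚ.≤-pred (ℕₚ.≤-pred (ℕₚ.≤-trans
    (s≤s (ℕₚ.≤-trans (ℕₚ.≤-reflexive (ℕₚ.+-comm 1 (suc n))) (ℕₚ.m≤m⊔n (suc n + 1) 3))) bound)))
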